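{- Over $m$ arc additions, topological search spends $\mathrm{O}(n^{5/2})$ total time.
   Context: Incremental setting: $n$ fixed vertices, initially no arcs; distinct arcs are added one at a time ($m$ in total) and processing stops after the addition that creates a cycle, if any. Vertices are numbered by a bijection $\mathit{position}$ onto $\{1,\dots,n\}$ with inverse array $\mathit{vertex}$ (initially arbitrary), maintained as a topological numbering; the graph is an adjacency matrix, so testing/adding an arc takes $\mathrm{O}(1)$. Queues support inject (append) and pop (remove front). When arc $(v,w)$ is added: if $\mathit{position}(v)<\mathit{position}(w)$ nothing is done. Otherwise topological search: $F=[w]$, $B=[v]$, $i=\mathit{position}(w)$, $j=\mathit{position}(v)$, $\mathit{vertex}(i)=\mathit{vertex}(j)=$ null. Repeat: $i=i+1$; while $i<j$ and no $u\in F$ has an arc $(u,\mathit{vertex}(i))$, $i=i+1$; if $i=j$ stop, else inject $\mathit{vertex}(i)$ into $F$ and set $\mathit{vertex}(i)=$ null; $j=j-1$; while $i<j$ and no $z\in B$ has an arc $(\mathit{vertex}(j),z)$, $j=j-1$; if $i=j$ stop, else inject $\mathit{vertex}(j)$ into $B$ and set $\mathit{vertex}(j)=$ null. Cycle test: report a cycle iff some arc $(u,z)$ has $u\in F$, $z\in B$. Otherwise reorder from the final $F,B,i,j$: while $F$ nonempty: if $\mathit{vertex}(i)\ne$ null and some $u$ currently in $F$ has an arc to $\mathit{vertex}(i)$, inject $\mathit{vertex}(i)$ into $F$ and set $\mathit{vertex}(i)=$ null; if $\mathit{vertex}(i)=$ null, pop $x$ from $F$, set $\mathit{vertex}(i)=x$,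 $\mathit{position}(x)=i$; $i=i+1$. While $B$ nonempty: $j=j-1$; if $\mathit{vertex}(j)\ne$ null and it has an arc to some $z$ currently in $B$, inject $\mathit{vertex}(j)$ into $B$ and set $\mathit{vertex}(j)=$ null; if $\mathit{vertex}(j)=$ null, pop $y$ from $B$, set $\mathit{vertex}(j)=y$, $\mathit{position}(y)=j$. -}

module Defs where

open import Data.Nat using (ℕ; zero; suc; _+_; _*_; _∸_; _<ᵇ_; _≡ᵇ_; _<?_)
open import Data.Bool using (Bool; true; false; if_then_else_; _∧_; _∨_; not)
open import Data.Fin using (Fin; toℕ; fromℕ<)
import Data.Fin as Fin
open import Data.List using (List; []; _∷_; _++_; [_]; length)
open import Data.Bool.ListAction using (any)
open import Data.Maybe using (Maybe; just; nothing)
open import Data.Product using (_×_; _,_)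
open import Relation.Nullary using (yes; no; does)
open import Function.Bundles using (_↔_; Inverse)

-- Conventions
--  * vertices are Fin n;
--  * positions are natural numbers, meaningful in 1..n;
--  * the graph is an adjacency matrix  G : Fin n → Fin n → Bool;
--  * vertex array: ℕ → Maybe (Fin n)   (nothing = null);
--  * queues are lists: inject = append at the end, pop = take the head.
--
-- Cost model (unit-cost RAM, O(1) matrix test): every loop-condition
-- evaluation / basic step costs 1, and a test "some u ∈ Q has an arc
-- to/from x" costs 1 + |Q| (one matrix lookup per element of Q).
-- The cycle test costs 1 + |F|·|B|.  Each arc addition costs 1 for the
-- comparison of positions.
--
-- Loops are run with a fuel bound (2n+5 iterations) which is never the
-- binding constraint (each loop moves i or j monotonically inside 0..n+1);
-- it only serves to make termination structural.

Graph : ℕ → Set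
Graph n = Fin n → Fin n → Bool

VArr : ℕ → Set
VArr n = ℕ → Maybe (Fin n)

PArr : ℕ → Set
PArr n = Fin n → ℕ

addArc : ∀ {n} → Graph n → Fin n → Fin n → Graph n
addArc G v w x y = (does (x Fin.≟ v) ∧ does (y Fin.≟ w)) ∨ G x y

setV : ∀ {n} → VArr n → ℕ → Maybe (Fin n) → VArr n
setV vtx p mx k = if k ≡ᵇ p then mx else vtx k

setP : ∀ {n} → PArr n → Fin n → ℕ → PArr n
setP pos x p y = if does (y Fin.≟ x) then p else pos y

arcFrom : ∀ {n} → Graph n → List (Fin n) → Fin n → Bool
arcFrom G F x = any (λ u → G u x) F

arcTo : ∀ {n} → Graph n → Fin n → List (Fin n) → Bool
arcTo G x B = any (λ z → G x z) B

arcFromM : ∀ {n} → Graph n → List (Fin n) → Maybe (Fin n) → Bool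
arcFromM G F nothing  = false
arcFromM G F (just x) = arcFrom G F x

arcToM : ∀ {n} → Graph n → Maybe (Fin n) → List (Fin n) → Bool
arcToM G nothing  B = false
arcToM G (just x) B = arcTo G x B

isNull : ∀ {n} → Maybe (Fin n) → Bool
isNull nothing  = true
isNull (just _) = false

record SearchState (n : ℕ) : Set where
  constructor sst
  field
    F    : List (Fin n)
    B    : List (Fin n)
    i    : ℕ
    j    : ℕ
    vtx  : VArr n
    cost : ℕ


mutual
  -- forward scan; called right after "i = i + 1"
  fwdScan : ∀ {n} → ℕ → Graph n → SearchState n → SearchState n
  fwdScan zero    G s = s
  fwdScan (suc k) G (sst F B i j vtx c) =
    if i <ᵇ j
    then (if arcFromM G F (vtx i)
          then injF (vtx i)
          else fwdScan k G (sst F B (suc i) j vtx (c + suc (length F))))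
    else sst F B i j vtx (suc c)
    where
    injF : Maybe (Fin _) → SearchState _
    injF nothing  = sst F B i j vtx (suc c)        -- unreachable
    injF (just x) = bwdScan k G (sst (F ++ [ x ]) B i (j ∸ 1)
                                     (setV vtx i nothing) (c + suc (length F)))

  -- backward scan; called right after "j = j - 1"
  bwdScan : ∀ {n} → ℕ → Graph n → SearchState n → SearchState n
  bwdScan zero    G s = s
  bwdScan (suc k) G (sst F B i j vtx c) =
    if i <ᵇ j
    then (if arcToM G (vtx j) B
          then injB (vtx j)
          else bwdScan k G (sst F B i (j ∸ 1) vtx (c + suc (length B))))
    else sst F B i j vtx (suc c)
    where
    injB : Maybe (Fin _) → SearchState _
    injB nothing  = sst F B i j vtx (suc c)        -- unreachable
    injB (just y) = fwdScan k G (sst F (B ++ [ y ]) (suc i) j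
                                     (setV vtx j nothing) (c + suc (length B)))

search : ∀ {n} → Graph n → PArr n → VArr n → Fin n → Fin n → SearchState n
search {n} G pos vtx v w =
  fwdScan (2 * n + 5) G
    (sst [ w ] [ v ] (suc (pos w)) (pos v)
         (setV (setV vtx (pos w) nothing) (pos v) nothing) 1)

cycleTest : ∀ {n} → Graph n → List (Fin n) → List (Fin n) → Bool
cycleTest G F B = any (λ u → any (λ z → G u z) B) F

record ReState (n : ℕ) : Set where
  constructor rst
  field
    Q     : List (Fin n)
    idx   : ℕ
    rvtx  : VArr n
    rpos  : PArr n
    rcost : ℕ

reorderF : ∀ {n} → ℕ → Graph n → ReState n → ReState n
reorderF zero    G s = s
reorderF (suc k) G (rst [] i vtx pos c) = rst [] i vtx pos (suc c)
reorderF (suc k) G (rst (u ∷ F) i vtx pos c) =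
  place F₁' vtx₁ (c + c₁)
  where
  F₀ = u ∷ F
  step1 : Maybe (Fin _) → List (Fin _) × VArr _ × ℕ
  step1 nothing  = F₀ , vtx , 1
  step1 (just x) = if arcFrom G F₀ x
                   then (F₀ ++ [ x ]) , setV vtx i nothing , suc (length F₀)
                   else F₀ , vtx , suc (length F₀)
  r = step1 (vtx i)
  F₁' = Data.Product.proj₁ r
  vtx₁ = Data.Product.proj₁ (Data.Product.proj₂ r)
  c₁ = Data.Product.proj₂ (Data.Product.proj₂ r)
  place : List (Fin _) → VArr _ → ℕ → ReState _
  place [] vtx' c' = rst [] (suc i) vtx' pos c'          -- unreachable
  place (x ∷ Fr) vtx' c' =
    if isNull (vtx' i)
    then reorderF k G (rst Fr (suc i) (setV vtx' i (just x)) (setP pos x i) (suc c'))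
    else reorderF k G (rst (x ∷ Fr) (suc i) vtx' pos (suc c'))

reorderB : ∀ {n} → ℕ → Graph n → ReState n → ReState n
reorderB zero    G s = s
reorderB (suc k) G (rst [] j vtx pos c) = rst [] j vtx pos (suc c)
reorderB (suc k) G (rst (z ∷ B) j₀ vtx pos c) =
  place B₁' vtx₁ (c + c₁)
  where
  j = j₀ ∸ 1
  B₀ = z ∷ B
  step1 : Maybe (Fin _) → List (Fin _) × VArr _ × ℕ
  step1 nothing  = B₀ , vtx , 1
  step1 (just y) = if arcTo G y B₀
                   then (B₀ ++ [ y ]) , setV vtx j nothing , suc (length B₀)
                   else B₀ , vtx , suc (length B₀)
  r = step1 (vtx j)
  B₁' = Data.Product.proj₁ r
  vtx₁ = Data.Product.proj₁ (Data.Product.proj₂ r)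
  c₁ = Data.Product.proj₂ (Data.Product.proj₂ r)
  place : List (Fin _) → VArr _ → ℕ → ReState _
  place [] vtx' c' = rst [] j vtx' pos c'                -- unreachable
  place (y ∷ Br) vtx' c' =
    if isNull (vtx' j)
    then reorderB k G (rst Br j (setV vtx' j (just y)) (setP pos y j) (suc c'))
    else reorderB k G (rst (y ∷ Br) j vtx' pos (suc c'))

record AlgState (n : ℕ) : Set where
  constructor ast
  field
    graph : Graph n
    pos   : PArr n
    vtx   : VArr n

data Outcome (n : ℕ) : Set where
  continue : AlgState n → ℕ → Outcome n
  cycle    : ℕ → Outcome n

addition : ∀ {n} → AlgState n → Fin n → Fin n → Outcome n
addition {n} (ast G pos vtx) v w =
  if pos v <ᵇ pos w
  then continue (ast G' pos vtx) 1
  else (if cycleTest G' F B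
        then cycle (1 + cs + ct)
        else continue (ast G' (ReState.rpos rB) (ReState.rvtx rB))
                      (1 + cs + ct + ReState.rcost rF + ReState.rcost rB))
  where
  G'  = addArc G v w
  s   = search G' pos vtx v w
  F   = SearchState.F s
  B   = SearchState.B s
  cs  = SearchState.cost s
  ct  = suc (length F * length B)
  rF  = reorderF (2 * n + 5) G' (rst F (SearchState.i s) (SearchState.vtx s) pos 0)
  rB  = reorderB (2 * n + 5) G' (rst B (SearchState.j s) (ReState.rvtx rF) (ReState.rpos rF) 0)

runCost : ∀ {n} → AlgState n → List (Fin n × Fin n) → ℕ
runCost s [] = 0
runCost s ((v , w) ∷ arcs) with addition s v w
... | continue s' c = c + runCost s' arcs
... | cycle c       = c

-- initial state: no arcs, topological numbering given by an arbitrary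
-- bijection σ : position(v) = 1 + σ(v), vertex(p) = σ⁻¹(p - 1)
initVtx : ∀ {n} → Fin n ↔ Fin n → VArr n
initVtx σ zero = nothing
initVtx {n} σ (suc k) with k <? n
... | yes k<n = just (Inverse.from σ (fromℕ< k<n))
... | no _    = nothing

initState : ∀ {n} → Fin n ↔ Fin n → AlgState n
initState σ = ast (λ _ _ → false) (λ v → suc (toℕ (Inverse.to σ v))) (initVtx σ)

totalCost : ∀ {n} → Fin n ↔ Fin n → List (Fin n × Fin n) → ℕ
totalCost σ arcs = runCost (initState σ) arcs

{-# OPTIONS --safe #-}

-- The cost of an addition without a cycle is O(T + 1), where T is the total distance
-- by which its reordering moves vertices up (equivalently, down).  To bound the sum of
-- the T, let lam be the final numbering and consider the potential Σ lam x * pos x ≤ n³.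
-- If x moves up and y moves down across a slot p, then y reaches v and w reaches x,
-- so lam y < lam x; moreover y precedes x in every later numbering, hence a
-- pair x, y crosses in only one addition.  Across each slot equally many vertices move
-- up and down.  So, for any L, each unit of movement raises the potential by at least L,
-- except for pairs with lam x < lam y + L; there are at most n L of these, each crosses
-- at most n slots, and each crossing loses at most L.  Thus L Σ T ≤ n³ + L² n², and
-- L = √n gives Σ T = O(n^{5/2}).

module Submission where

-- Why the cost is O(T + 1): a scan step tests a whole queue and advances by one slot, so the search
-- costs about the sum, over the collected vertices, of their distances to the slot t where the
-- scans meet. Reordering carries `F` to t or above and `B` below t, so actual movement bounds these
-- distances. The queue lengths differ by at most one, hence the search cost covers |F| |B|. Up to
-- the slot t itself, each queue refills the slots vacated by the other one, so the reordering is
-- charged to the same distances. Since `lam` is known only at the end of the run, the bound is an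
-- induction on the remaining arcs in which the recursive call supplies `lam`. If a cycle ends the
-- run, `lam` is the numbering before the fatal arc, whose O(n²) cost is paid once. The +1 per
-- addition sums to at most n², as the arcs are distinct. Reachability is expressed through all
-- topological numberings instead of paths, which is the form in which `lam` uses it. Squaring the
-- final estimate keeps n^(5/2) within the natural numbers.

open import Defs
open import Data.Nat
open import Data.Nat.Properties
open import Data.Nat.ListAction using () renaming (sum to sumₗ)
open import Data.Nat.Tactic.RingSolver using (solve-∀)
open import Data.Bool using (Bool; true; false; T; if_then_else_; _∧_; _∨_)
open import Data.Bool.Properties using (∨-zeroʳ)
open import Data.Bool.ListAction using (any)
open import Data.Fin using (Fin; toℕ; fromℕ<)
import Data.Fin as Fin
import Data.Fin.Properties as Fin
open import Data.Fin.Permutation using (Permutation′; permutation; _⟨$⟩ʳ_)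
open import Data.List using (List; []; _∷_; _++_; [_]; map; length; mapMaybe; iterate)
import Data.List.Properties as List
open import Data.List.Membership.Propositional using (_∈_; _∉_)
open import Data.List.Membership.Propositional.Properties using (∈-++⁺ˡ; ∈-++⁺ʳ; ∈-++⁻)
open import Data.List.Relation.Unary.Any using (here; there)
open import Data.List.Relation.Unary.All using (All; []; _∷_)
import Data.List.Relation.Unary.All as All
import Data.List.Relation.Unary.All.Properties as All
open import Data.List.Relation.Unary.AllPairs using (AllPairs; []; _∷_)
import Data.List.Relation.Unary.AllPairs as AllPairs
import Data.List.Relation.Unary.AllPairs.Properties as AllPairs
open import Data.List.Relation.Unary.Unique.Propositional using (Unique)
import Data.List.Relation.Unary.Unique.Propositional.Properties as Unique
open import Data.List.Relation.Binary.Permutation.Propositional using (_↭_; ↭-refl; ↭-sym; ↭-trans; prep; swap; ↭⇒↭ₛ)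
import Data.List.Relation.Binary.Permutation.Setoid.Properties as PermS
import Data.List.Relation.Binary.Permutation.Propositional.Properties as Perm
open import Data.Maybe using (Maybe; just; nothing)
open import Data.Maybe.Properties using (just-injective)
open import Data.Product using (_×_; _,_; ∃; proj₁; proj₂)
open import Data.Sum as Sum using (_⊎_; inj₁; inj₂)
open import Data.Empty using (⊥-elim)
open import Function using (_∘_; flip)
open import Function.Bundles using (_↔_; Inverse)
open import Relation.Nullary using (Dec; yes; no; ¬_; contradiction; does)
open import Relation.Nullary.Decidable using (_×-dec_; dec-true; dec-false)
open import Relation.Binary.PropositionalEquality hiding ([_])
import Algebra.Properties.Semiring.Sum +-*-semiring as ΣSum

-- Finite sums

ind : ∀ {p} {P : Set p} → Dec P → ℕ
ind (yes _) = 1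
ind (no  _) = 0

ind-cong : ∀ {p q} {P : Set p} {Q : Set q} (P? : Dec P) (Q? : Dec Q) →
           (P → Q) → (Q → P) → ind P? ≡ ind Q?
ind-cong (yes _) (yes _) _ _ = refl
ind-cong (yes p) (no ¬q) f _ = contradiction (f p) ¬q
ind-cong (no ¬p) (yes q) _ g = contradiction (g q) ¬p
ind-cong (no _)  (no _)  _ _ = refl

ind-yes : ∀ {p} {P : Set p} (P? : Dec P) → P → ind P? ≡ 1
ind-yes P? p = ind-cong P? (yes p) (λ x → x) (λ x → x)

ind≤1 : ∀ {p} {P : Set p} (P? : Dec P) → ind P? ≤ 1
ind≤1 (yes _) = ≤-refl
ind≤1 (no  _) = z≤n

-- Sums are opaque so that their summands can be inferred by unification.
opaque
  sum : ∀ {n} → (Fin n → ℕ) → ℕ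
  sum = ΣSum.sum

  sum-cong-≗ : ∀ {n} {f g : Fin n → ℕ} → (∀ i → f i ≡ g i) → sum f ≡ sum g
  sum-cong-≗ = ΣSum.sum-cong-≗

  ∑-distrib-+ : ∀ {n} (f g : Fin n → ℕ) → sum (λ i → f i + g i) ≡ sum f + sum g
  ∑-distrib-+ = ΣSum.∑-distrib-+

  ∑-comm : ∀ {m n} (f : Fin m → Fin n → ℕ) → sum (λ i → sum (f i)) ≡ sum (λ j → sum (λ i → f i j))
  ∑-comm = ΣSum.∑-comm

  sum-permute : ∀ {n} (f : Fin n → ℕ) (π : Permutation′ n) → sum f ≡ sum (f ∘ (π ⟨$⟩ʳ_))
  sum-permute = ΣSum.sum-permute

  *-distribˡ-sum : ∀ {n} k (f : Fin n → ℕ) → k * sum f ≡ sum (λ i → k * f i)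
  *-distribˡ-sum = ΣSum.*-distribˡ-sum

  *-distribʳ-sum : ∀ {n} k (f : Fin n → ℕ) → sum f * k ≡ sum (λ i → f i * k)
  *-distribʳ-sum = ΣSum.*-distribʳ-sum

opaque
  unfolding sum

  sum-mono : ∀ {n} {f g : Fin n → ℕ} → (∀ i → f i ≤ g i) → sum f ≤ sum g
  sum-mono {zero}  f≤g = z≤n
  sum-mono {suc n} f≤g = +-mono-≤ (f≤g Fin.zero) (sum-mono (f≤g ∘ Fin.suc))

opaque
  unfolding sum

  sum-const : ∀ n k → sum {n} (λ _ → k) ≡ n * k
  sum-const zero    k = refl
  sum-const (suc n) k = cong (k +_) (sum-const n k)

sum-≤-const : ∀ {n} {f : Fin n → ℕ} k → (∀ i → f i ≤ k) → sum f ≤ n * k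
sum-≤-const {n} k f≤k = ≤-trans (sum-mono f≤k) (≤-reflexive (sum-const n k))

sum-zero : ∀ {n} {f : Fin n → ℕ} → (∀ i → f i ≡ 0) → sum f ≡ 0
sum-zero {n} f≡0 = trans (sum-cong-≗ f≡0) (trans (sum-const n 0) (*-zeroʳ n))

opaque
  unfolding sum

  term≤sum : ∀ {n} (f : Fin n → ℕ) i → f i ≤ sum f
  term≤sum f Fin.zero    = m≤m+n _ _
  term≤sum f (Fin.suc i) = ≤-trans (term≤sum (f ∘ Fin.suc) i) (m≤n+m _ _)

without : ∀ {n} → Fin n → (Fin n → ℕ) → Fin n → ℕ
without i f j with i Fin.≟ j
... | yes _ = 0
... | no  _ = f j

without-≢ : ∀ {n} {i j : Fin n} (f : Fin n → ℕ) → i ≢ j → without i f j ≡ f j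
without-≢ {i = i} {j} f i≢j with i Fin.≟ j
... | yes i≡j = contradiction i≡j i≢j
... | no  _   = refl

sum-split : ∀ {n} (f : Fin n → ℕ) i → f i + sum (without i f) ≤ sum f
sum-split {n} f i = begin
  f i + sum (without i f)                  ≤⟨ +-monoˡ-≤ _ (≤-trans at-i (term≤sum only i)) ⟩
  sum only + sum (without i f)             ≡⟨ ∑-distrib-+ only (without i f) ⟨
  sum (λ j → only j + without i f j)       ≤⟨ sum-mono pointwise ⟩
  sum f                                    ∎
  where
  open ≤-Reasoning
  only : Fin n → ℕ
  only j = ind (i Fin.≟ j) * f j
  at-i : f i ≤ only i
  at-i = ≤-reflexive (sym (trans (cong (_* f i) (ind-yes (i Fin.≟ i) refl)) (*-identityˡ (f i))))
  pointwise : ∀ j → only j + without i f j ≤ f j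
  pointwise j with i Fin.≟ j
  ... | yes _ = ≤-reflexive (trans (+-identityʳ _) (+-identityʳ _))
  ... | no  _ = ≤-refl

-- Queues hold distinct vertices, so whatever is charged to their elements is bounded by a sum over
-- all vertices.
unique-sum≤sum : ∀ {n} (f : Fin n → ℕ) {xs} → Unique xs → sumₗ (map f xs) ≤ sum f
unique-sum≤sum f [] = z≤n
unique-sum≤sum f {x ∷ xs} (x∉xs ∷ uniq) = begin
  f x + sumₗ (map f xs)             ≡⟨ cong (f x +_) (away x∉xs) ⟨
  f x + sumₗ (map (without x f) xs) ≤⟨ +-monoʳ-≤ (f x) (unique-sum≤sum (without x f) uniq) ⟩
  f x + sum (without x f)               ≤⟨ sum-split f x ⟩
  sum f                                 ∎
  where
  open ≤-Reasoning
  away : ∀ {ys} → All (x ≢_) ys → sumₗ (map (without x f) ys) ≡ sumₗ (map f ys)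
  away []           = refl
  away (x≢y ∷ x≢ys) = cong₂ _+_ (without-≢ f x≢y) (away x≢ys)

unique-length≤ : ∀ {n} {xs : List (Fin n)} → Unique xs → length xs ≤ n
unique-length≤ {n} {xs} uniq = begin
  length xs                       ≡⟨ ones xs ⟨
  sumₗ (map (λ _ → 1) xs)     ≤⟨ unique-sum≤sum (λ _ → 1) uniq ⟩
  sum {n} (λ _ → 1)               ≡⟨ trans (sum-const n 1) (*-identityʳ n) ⟩
  n                               ∎
  where
  open ≤-Reasoning
  ones : ∀ (ys : List (Fin n)) → sumₗ (map (λ _ → 1) ys) ≡ length ys
  ones []       = refl
  ones (_ ∷ ys) = cong suc (ones ys)

opaque
  unfolding sum

  -- Truncated subtraction also covers an empty interval, so the distance moved in one direction is
  -- a count of crossed slots without a case distinction on the direction of the move.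
  sum-interval : ∀ n a b → b ≤ n → sum {n} (λ p → ind (a ≤? toℕ p ×-dec toℕ p <? b)) ≡ b ∸ a
  sum-interval n a zero b≤n = trans (sum-zero none) (sym (0∸n≡0 a))
    where
    none : ∀ p → ind (a ≤? toℕ {n} p ×-dec toℕ p <? zero) ≡ 0
    none p with a ≤? toℕ p ×-dec toℕ p <? zero
    ... | no _ = refl
  sum-interval (suc n) zero (suc b) (s≤s b≤n) = cong₂ _+_ refl
    (trans (sum-cong-≗ {n} (λ p → ind-cong (zero ≤? suc (toℕ p) ×-dec suc (toℕ p) <? suc b) (zero ≤? toℕ p ×-dec toℕ p <? b)
                       (λ (_ , q) → z≤n , s≤s⁻¹ q) (λ (_ , q) → z≤n , s≤s q)))
           (sum-interval n zero b b≤n))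
  sum-interval (suc n) (suc a) (suc b) (s≤s b≤n) = cong₂ _+_ (out (suc a ≤? 0 ×-dec 0 <? suc b))
    (trans (sum-cong-≗ {n} (λ p → ind-cong (suc a ≤? suc (toℕ p) ×-dec suc (toℕ p) <? suc b) (a ≤? toℕ p ×-dec toℕ p <? b)
                       (λ (r , q) → s≤s⁻¹ r , s≤s⁻¹ q) (λ (r , q) → s≤s r , s≤s q)))
           (sum-interval n a b b≤n))
    where
    out : (d : Dec (suc a ≤ 0 × 0 < suc b)) → ind d ≡ 0
    out (no _) = refl

opaque
  unfolding sum

  sum-hits≤1 : ∀ {n} (f : Fin n → ℕ) → (∀ i j → f i ≡ f j → i ≡ j) → ∀ a → sum (λ i → ind (f i ≟ a)) ≤ 1
  sum-hits≤1 {zero}  f inj a = z≤n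
  sum-hits≤1 {suc n} f inj a with f Fin.zero ≟ a
  ... | no  _  = sum-hits≤1 (f ∘ Fin.suc) (λ i j e → Fin.suc-injective (inj _ _ e)) a
  ... | yes f₀≡a = ≤-reflexive (cong suc (sum-zero miss))
    where
    miss : ∀ i → ind (f (Fin.suc i) ≟ a) ≡ 0
    miss i with f (Fin.suc i) ≟ a
    ... | no _ = refl
    ... | yes fᵢ≡a with () ← inj Fin.zero (Fin.suc i) (trans f₀≡a (sym fᵢ≡a))

sum-product : ∀ {m n} (f : Fin m → ℕ) (g : Fin n → ℕ) →
              sum (λ i → sum (λ j → f i * g j)) ≡ sum f * sum g
sum-product f g = trans (sum-cong-≗ (λ i → sym (*-distribˡ-sum (f i) g))) (sym (*-distribʳ-sum (sum g) f))

sum₂-distrib-+ : ∀ {m n} (f g : Fin m → Fin n → ℕ) →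
  sum (λ i → sum (λ j → f i j + g i j)) ≡ sum (λ i → sum (f i)) + sum (λ i → sum (g i))
sum₂-distrib-+ f g = trans (sum-cong-≗ (λ i → ∑-distrib-+ (f i) (g i))) (∑-distrib-+ (sum ∘ f) (sum ∘ g))

sum₂-distribˡ-* : ∀ {m n} k (f : Fin m → Fin n → ℕ) →
  sum (λ i → sum (λ j → k * f i j)) ≡ k * sum (λ i → sum (f i))
sum₂-distribˡ-* k f = trans (sum-cong-≗ (λ i → sym (*-distribˡ-sum k (f i)))) (sym (*-distribˡ-sum k (sum ∘ f)))

-- Movement between two numberings

unset : Bool → ℕ
unset true  = 0
unset false = 1

module Near {n} (L : ℕ) (lam : Fin n → ℕ) where

  -- near x y = 1 if lam y ≤ lam x < lam y + L, and 0 otherwise.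
  near : Fin n → Fin n → ℕ
  near x y = sum {L} (λ k → ind (lam y + toℕ k ≟ lam x))

  -- Either the gap is at least L and `lam x` alone suffices, or the pair is near and the extra L
  -- compensates.
  near-gap : ∀ {x y} → lam y ≤ lam x → L + lam y ≤ lam x + L * near x y
  near-gap {x} {y} y≤x with (lam x ∸ lam y) <? L
  ... | no  far = ≤-trans (≤-trans (+-monoˡ-≤ (lam y) (≮⇒≥ far)) (≤-reflexive (m∸n+n≡m y≤x))) (m≤m+n _ _)
  ... | yes d<L = ≤-trans (≤-reflexive (+-comm L (lam y))) (+-mono-≤ y≤x (m≤m*n′ L hit))
    where
    hit : 1 ≤ near x y
    hit = ≤-trans (≤-reflexive (sym (ind-yes (_ ≟ _)
            (trans (cong (lam y +_) (Fin.toℕ-fromℕ< d<L)) (m+[n∸m]≡n y≤x)))))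
          (term≤sum (λ k → ind (lam y + toℕ k ≟ lam x)) (fromℕ< d<L))
    m≤m*n′ : ∀ m {k} → 1 ≤ k → m ≤ m * k
    m≤m*n′ m 1≤k = ≤-trans (≤-reflexive (sym (*-identityʳ m))) (*-monoʳ-≤ m 1≤k)

  potential : (Fin n → ℕ) → ℕ
  potential q = sum (λ x → lam x * q x)

  openPairs : (Fin n → Fin n → Bool) → ℕ
  openPairs S = sum (λ x → sum (λ y → near x y * unset (S x y)))

  -- After exchanging the sums, each offset k < L is attained by at most one y for a given x,
  -- because `lam` is injective. So every x has at most L near partners.
  openPairs≤ : (∀ x y → lam x ≡ lam y → x ≡ y) → ∀ S → openPairs S ≤ n * L
  openPairs≤ inj S = sum-≤-const L (λ x → begin
    sum (λ y → near x y * unset (S x y))                    ≤⟨ sum-mono (λ y → *-monoʳ-≤ (near x y) (unset≤1 (S x y))) ⟩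
    sum (λ y → near x y * 1)                                ≡⟨ sum-cong-≗ (λ y → *-identityʳ (near x y)) ⟩
    sum (near x)                                            ≡⟨ ∑-comm _ ⟩
    sum {L} (λ k → sum (λ y → ind (lam y + toℕ k ≟ lam x))) ≤⟨ sum-≤-const {L} 1 (λ k →
      sum-hits≤1 (λ y → lam y + toℕ k) (λ i j e → inj i j (+-cancelʳ-≡ (toℕ k) _ _ e)) (lam x)) ⟩
    L * 1                                                   ≡⟨ *-identityʳ L ⟩
    L                                                       ∎)
    where
    open ≤-Reasoning
    unset≤1 : ∀ b → unset b ≤ 1
    unset≤1 true  = z≤n
    unset≤1 false = ≤-refl

module Balance {n} (pos pos′ : Fin n → ℕ)
  (same-count : ∀ p → sum (λ x → ind (pos x ≤? p)) ≡ sum (λ x → ind (pos′ x ≤? p)))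
  (pos≤n : ∀ x → pos x ≤ n) (pos′≤n : ∀ x → pos′ x ≤ n) where

  up down : ℕ → Fin n → ℕ
  up   p x = ind (pos x ≤? p ×-dec p <? pos′ x)
  down p y = ind (pos′ y ≤? p ×-dec p <? pos y)

  up-down-balance : ∀ p x → ind (pos x ≤? p) + down p x ≡ ind (pos′ x ≤? p) + up p x
  up-down-balance p x with pos x ≤? p | pos′ x ≤? p | p <? pos x | p <? pos′ x
  ... | yes a | yes b | yes c | _     = contradiction a (<⇒≱ c)
  ... | yes a | yes b | no  c | yes d = contradiction b (<⇒≱ d)
  ... | yes a | yes b | no  c | no  d = refl
  ... | yes a | no  b | _     | yes d = refl
  ... | yes a | no  b | _     | no  d = contradiction (≰⇒> b) d
  ... | no  a | yes b | yes c | _     = refl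
  ... | no  a | yes b | no  c | _     = contradiction (≰⇒> a) c
  ... | no  a | no  b | _     | _     = refl

  -- Equally many vertices lie at or below p before and after; those that leave this region upwards
  -- must therefore be replaced by as many that enter it from above.
  up≡down : ∀ p → sum (up p) ≡ sum (down p)
  up≡down p = sym (+-cancelˡ-≡ (sum (λ x → ind (pos x ≤? p))) _ _ (begin
    sum (λ x → ind (pos x ≤? p)) + sum (down p)    ≡⟨ ∑-distrib-+ _ (down p) ⟨
    sum (λ x → ind (pos x ≤? p) + down p x)        ≡⟨ sum-cong-≗ (up-down-balance p) ⟩
    sum (λ x → ind (pos′ x ≤? p) + up p x)         ≡⟨ ∑-distrib-+ _ (up p) ⟩
    sum (λ x → ind (pos′ x ≤? p)) + sum (up p)     ≡⟨ cong (_+ sum (up p)) (same-count p) ⟨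
    sum (λ x → ind (pos x ≤? p)) + sum (up p)      ∎))
    where open ≡-Reasoning

  ups downs : Fin n → ℕ
  ups   x = pos′ x ∸ pos x
  downs y = pos y ∸ pos′ y

  sum-up : ∀ x → sum {n} (λ p → up (toℕ p) x) ≡ ups x
  sum-up x = sum-interval n (pos x) (pos′ x) (pos′≤n x)

  sum-down : ∀ y → sum {n} (λ p → down (toℕ p) y) ≡ downs y
  sum-down y = sum-interval n (pos′ y) (pos y) (pos≤n y)

  total-up : sum {n} (λ p → sum (up (toℕ p))) ≡ sum ups
  total-up = trans (∑-comm _) (sum-cong-≗ sum-up)

  ups≡downs : sum ups ≡ sum downs
  ups≡downs = begin
    sum ups                              ≡⟨ total-up ⟨
    sum {n} (λ p → sum (up (toℕ p)))     ≡⟨ sum-cong-≗ {n} (up≡down ∘ toℕ) ⟩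
    sum {n} (λ p → sum (down (toℕ p)))   ≡⟨ ∑-comm _ ⟩
    sum (λ y → sum {n} (λ p → down (toℕ p) y)) ≡⟨ sum-cong-≗ sum-down ⟩
    sum downs                            ∎
    where open ≡-Reasoning

module Slices {n} (pos pos′ : Fin n → ℕ)
  (same-count : ∀ p → sum (λ x → ind (pos x ≤? p)) ≡ sum (λ x → ind (pos′ x ≤? p)))
  (pos≤n : ∀ x → pos x ≤ n) (pos′≤n : ∀ x → pos′ x ≤ n)
  (L : ℕ) (lam : Fin n → ℕ) (crossing : ∀ x y → pos x < pos′ x → pos′ y < pos y → lam y ≤ lam x) where

  open Near L lam
  open Balance pos pos′ same-count pos≤n pos′≤n

  nearPairs : ℕ → ℕ
  nearPairs p = sum (λ x → sum (λ y → near x y * (up p x * down p y)))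

  -- Every vertex moving up across p is compared with every vertex moving down
  -- across p, so both sides are first obtained with an extra factor k.
  slice : ∀ p → L * sum (up p) + sum (λ y → lam y * down p y)
              ≤ sum (λ x → lam x * up p x) + L * nearPairs p
  slice p = cancel (sum (up p)) refl
    where
    open ≤-Reasoning
    k = sum (up p)
    X = sum (λ x → lam x * up p x)
    Y = sum (λ y → lam y * down p y)
    pointwise : ∀ x y → up p x * (L * down p y) + up p x * (lam y * down p y)
                      ≤ (lam x * up p x) * down p y + L * (near x y * (up p x * down p y))
    pointwise x y with pos x ≤? p ×-dec p <? pos′ x | pos′ y ≤? p ×-dec p <? pos y
    ... | no _ | _ = z≤n
    ... | yes _ | no _ = ≤-trans (≤-reflexive (zeros L (lam y))) z≤n
      where
      zeros : ∀ a b → 1 * (a * 0) + 1 * (b * 0) ≡ 0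
      zeros = solve-∀
    ... | yes (a , b) | yes (c , d) = begin
      1 * (L * 1) + 1 * (lam y * 1)        ≡⟨ tidyˡ L (lam y) ⟩
      L + lam y                            ≤⟨ near-gap (crossing x y (≤-<-trans a b) (≤-<-trans c d)) ⟩
      lam x + L * near x y                 ≡⟨ tidyʳ L (lam x) (near x y) ⟩
      (lam x * 1) * 1 + L * (near x y * (1 * 1)) ∎
      where
      tidyˡ : ∀ a b → 1 * (a * 1) + 1 * (b * 1) ≡ a + b
      tidyˡ = solve-∀
      tidyʳ : ∀ a b c → b + a * c ≡ (b * 1) * 1 + a * (c * (1 * 1))
      tidyʳ = solve-∀
    scaled : k * (L * k + Y) ≤ k * X + L * nearPairs p
    scaled = begin
      k * (L * k + Y)                      ≡⟨ *-distribˡ-+ k (L * k) Y ⟩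
      k * (L * k) + k * Y                  ≡⟨ cong (λ z → k * (L * z) + k * Y) (up≡down p) ⟩
      k * (L * sum (down p)) + k * Y       ≡⟨ cong (λ z → k * z + k * Y) (*-distribˡ-sum L (down p)) ⟩
      k * sum (λ y → L * down p y) + k * Y ≡⟨ cong₂ _+_ (sum-product (up p) _) (sum-product (up p) _) ⟨
      sum (λ x → sum (λ y → up p x * (L * down p y))) + sum (λ x → sum (λ y → up p x * (lam y * down p y)))
                                           ≡⟨ sum₂-distrib-+ _ _ ⟨
      sum (λ x → sum (λ y → up p x * (L * down p y) + up p x * (lam y * down p y)))
                                           ≤⟨ sum-mono (λ x → sum-mono (pointwise x)) ⟩
      sum (λ x → sum (λ y → (lam x * up p x) * down p y + L * (near x y * (up p x * down p y))))
                                           ≡⟨ sum₂-distrib-+ _ _ ⟩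
      sum (λ x → sum (λ y → (lam x * up p x) * down p y)) + sum (λ x → sum (λ y → L * (near x y * (up p x * down p y))))
                                           ≡⟨ cong₂ _+_ (sum-product _ (down p)) (sum₂-distribˡ-* L _) ⟩
      X * sum (down p) + L * nearPairs p   ≡⟨ cong (λ z → X * z + L * nearPairs p) (up≡down p) ⟨
      X * k + L * nearPairs p              ≡⟨ cong (_+ L * nearPairs p) (*-comm X k) ⟩
      k * X + L * nearPairs p              ∎
    down≡0 : k ≡ 0 → ∀ y → down p y ≡ 0
    down≡0 k≡0 y = n≤0⇒n≡0 (≤-trans (term≤sum (down p) y) (≤-reflexive (trans (sym (up≡down p)) k≡0)))
    cancel : ∀ j → k ≡ j → L * k + Y ≤ X + L * nearPairs p
    -- The factor k cannot be cancelled here, but if nothing rises across p then nothing falls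
    -- across it, and the left side vanishes.
    cancel zero k≡0 = ≤-trans (≤-reflexive (cong₂ _+_ (trans (cong (L *_) k≡0) (*-zeroʳ L))
      (sum-zero (λ y → trans (cong (lam y *_) (down≡0 k≡0 y)) (*-zeroʳ (lam y)))))) z≤n
    cancel (suc j) k≡1+j = *-cancelˡ-≤ (suc j) (begin
      suc j * (L * k + Y)                        ≡⟨ cong (_* (L * k + Y)) k≡1+j ⟨
      k * (L * k + Y)                            ≤⟨ scaled ⟩
      k * X + L * nearPairs p                    ≡⟨ cong (λ z → z * X + L * nearPairs p) k≡1+j ⟩
      -- The near pairs are already counted per pair and carry no factor k; enlarging their term
      -- makes the whole right side divisible by k.
      suc j * X + L * nearPairs p                ≤⟨ +-monoʳ-≤ (suc j * X) (m≤m+n _ _) ⟩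
      suc j * X + suc j * (L * nearPairs p)      ≡⟨ *-distribˡ-+ (suc j) X _ ⟨
      suc j * (X + L * nearPairs p)              ∎)

  -- The number of slots that x crosses upwards and y crosses downwards, which is the number of
  -- times this pair appears in the sum over all slices.
  meet : Fin n → Fin n → ℕ
  meet x y = sum {n} (λ p → up (toℕ p) x * down (toℕ p) y)

  weighted : (g : ℕ → Fin n → ℕ) (h : Fin n → ℕ) → (∀ x → sum {n} (λ p → g (toℕ p) x) ≡ h x) →
             sum {n} (λ p → sum (λ x → lam x * g (toℕ p) x)) ≡ sum (λ x → lam x * h x)
  weighted g h eq = trans (∑-comm _) (sum-cong-≗ (λ x →
    trans (sym (*-distribˡ-sum (lam x) (λ p → g (toℕ p) x))) (cong (lam x *_) (eq x))))

  total-nearPairs : sum {n} (nearPairs ∘ toℕ) ≡ sum (λ x → sum (λ y → near x y * meet x y))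
  total-nearPairs = trans (∑-comm _) (sum-cong-≗ (λ x → trans (∑-comm _) (sum-cong-≗ (λ y →
    sym (*-distribˡ-sum (near x y) (λ p → up (toℕ p) x * down (toℕ p) y))))))

  all-slices : L * sum ups + sum (λ y → lam y * downs y)
             ≤ sum (λ x → lam x * ups x) + L * sum (λ x → sum (λ y → near x y * meet x y))
  all-slices = begin
    L * sum ups + sum (λ y → lam y * downs y)
      ≡⟨ cong₂ _+_ (cong (L *_) total-up) (weighted down downs sum-down) ⟨
    L * sum {n} (λ p → sum (up (toℕ p))) + sum {n} (λ p → sum (λ y → lam y * down (toℕ p) y))
      ≡⟨ cong (_+ sum {n} (λ p → sum (λ y → lam y * down (toℕ p) y))) (*-distribˡ-sum {n} L _) ⟩
    sum {n} (λ p → L * sum (up (toℕ p))) + sum {n} (λ p → sum (λ y → lam y * down (toℕ p) y))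
      ≡⟨ ∑-distrib-+ {n} _ _ ⟨
    sum {n} (λ p → L * sum (up (toℕ p)) + sum (λ y → lam y * down (toℕ p) y))
      ≤⟨ sum-mono {n} (slice ∘ toℕ) ⟩
    sum {n} (λ p → sum (λ x → lam x * up (toℕ p) x) + L * nearPairs (toℕ p))
      ≡⟨ ∑-distrib-+ {n} _ _ ⟩
    sum {n} (λ p → sum (λ x → lam x * up (toℕ p) x)) + sum {n} (λ p → L * nearPairs (toℕ p))
      ≡⟨ cong₂ _+_ (weighted up ups sum-up)
           (trans (sym (*-distribˡ-sum {n} L (nearPairs ∘ toℕ))) (cong (L *_) total-nearPairs)) ⟩
    sum (λ x → lam x * ups x) + L * sum (λ x → sum (λ y → near x y * meet x y)) ∎
    where open ≤-Reasoning

  -- Rises add `lam x * ups x` to the potential and falls take `lam y * downs y` away. The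
  -- contribution of the rises is added on both sides, so that no subtraction occurs.
  potential-step : L * sum ups + potential pos
                 ≤ potential pos′ + L * sum (λ x → sum (λ y → near x y * meet x y))
  potential-step = +-cancelʳ-≤ (sum (λ x → lam x * ups x)) _ _ (begin
    (L * sum ups + potential pos) + U         ≡⟨ +-assoc (L * sum ups) _ _ ⟩
    L * sum ups + (potential pos + U)         ≡⟨ cong (L * sum ups +_) moved ⟩
    L * sum ups + (D + potential pos′)        ≡⟨ +-assoc (L * sum ups) D _ ⟨
    (L * sum ups + D) + potential pos′        ≤⟨ +-monoˡ-≤ (potential pos′) all-slices ⟩
    (U + L * N) + potential pos′              ≡⟨ rearrange U (L * N) (potential pos′) ⟩
    (potential pos′ + L * N) + U              ∎)
    where
    open ≤-Reasoning
    U = sum (λ x → lam x * ups x)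
    D = sum (λ y → lam y * downs y)
    N = sum (λ x → sum (λ y → near x y * meet x y))
    rearrange : ∀ a b c → (a + b) + c ≡ (c + b) + a
    rearrange = solve-∀
    swap-∸ : ∀ a b → a + (b ∸ a) ≡ (a ∸ b) + b
    swap-∸ a b with ≤-total a b
    ... | inj₁ a≤b = trans (m+[n∸m]≡n a≤b) (cong (_+ b) (sym (m≤n⇒m∸n≡0 a≤b)))
    ... | inj₂ b≤a = trans (cong (a +_) (m≤n⇒m∸n≡0 b≤a)) (trans (+-identityʳ a) (sym (m∸n+n≡m b≤a)))
    pointwise : ∀ x → lam x * pos x + lam x * ups x ≡ lam x * downs x + lam x * pos′ x
    pointwise x = trans (sym (*-distribˡ-+ (lam x) _ _))
      (trans (cong (lam x *_) (swap-∸ (pos x) (pos′ x))) (*-distribˡ-+ (lam x) _ _))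
    moved : potential pos + U ≡ D + potential pos′
    moved = trans (sym (∑-distrib-+ _ _)) (trans (sum-cong-≗ pointwise) (∑-distrib-+ _ _))

  module _ (S : Fin n → Fin n → Bool) (ordered : ∀ x y → S x y ≡ true → pos y < pos x) where

    -- The last conjunct holds whenever x and y share a slot. It contradicts `ordered`, so a pair
    -- already in S never meets again.
    crossed? : ∀ x y → Dec ((pos x < pos′ x × pos′ y < pos y) × pos x < pos y)
    crossed? x y = (pos x <? pos′ x ×-dec pos′ y <? pos y) ×-dec pos x <? pos y

    S′ : Fin n → Fin n → Bool
    S′ x y = S x y ∨ does (crossed? x y)

    meet≤n : ∀ x y → meet x y ≤ n
    meet≤n x y = ≤-trans (sum-≤-const {n} 1 (λ p → *-mono-≤ (ind≤1 (pos x ≤? _ ×-dec _ <? pos′ x))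
                                                         (ind≤1 (pos′ y ≤? _ ×-dec _ <? pos y))))
                         (≤-reflexive (*-identityʳ n))

    meet≡0 : ∀ x y → ¬ ((pos x < pos′ x × pos′ y < pos y) × pos x < pos y) → meet x y ≡ 0
    meet≡0 x y no-cross = sum-zero {n} term
      where
      term : ∀ p → up (toℕ p) x * down (toℕ p) y ≡ 0
      term p with pos x ≤? toℕ p ×-dec toℕ p <? pos′ x | pos′ y ≤? toℕ p ×-dec toℕ p <? pos y
      ... | no _ | _ = refl
      ... | yes _ | no _ = refl
      ... | yes (a , b) | yes (c , d) =
        contradiction ((≤-<-trans a b , ≤-<-trans c d) , ≤-<-trans a d) no-cross

    -- A pair in S has no common slot. A pair that crosses now enters `S′`, and the n units freed in
    -- this way pay for its at most n common slots. Any other pair has no common slot either.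
    meet-unset : ∀ x y → meet x y + n * unset (S′ x y) ≤ n * unset (S x y)
    meet-unset x y with S x y in Sxy
    ... | true  = ≤-reflexive (cong (_+ n * 0) (meet≡0 x y (λ (_ , lt) → <-asym lt (ordered x y Sxy))))
    ... | false with crossed? x y
    ...   | yes c = ≤-trans (≤-reflexive (trans (cong (λ b → meet x y + n * unset b) (dec-true (crossed? x y) c))
                        (trans (cong (meet x y +_) (*-zeroʳ n)) (+-identityʳ _))))
                      (≤-trans (meet≤n x y) (≤-reflexive (sym (*-identityʳ n))))
    ...   | no ¬c = ≤-reflexive (cong₂ (λ m b → m + n * unset b) (meet≡0 x y ¬c) (dec-false (crossed? x y) ¬c))

    meet-open : sum (λ x → sum (λ y → near x y * meet x y)) + n * openPairs S′ ≤ n * openPairs S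
    meet-open = begin
      sum (λ x → sum (λ y → near x y * meet x y)) + n * openPairs S′
        ≡⟨ cong (_ +_) (sum₂-distribˡ-* n _) ⟨
      sum (λ x → sum (λ y → near x y * meet x y)) + sum (λ x → sum (λ y → n * (near x y * unset (S′ x y))))
        ≡⟨ sum₂-distrib-+ _ _ ⟨
      sum (λ x → sum (λ y → near x y * meet x y + n * (near x y * unset (S′ x y))))
        ≤⟨ sum-mono (λ x → sum-mono (λ y → pointwise x y)) ⟩
      sum (λ x → sum (λ y → n * (near x y * unset (S x y))))
        ≡⟨ sum₂-distribˡ-* n _ ⟩
      n * openPairs S ∎
      where
      open ≤-Reasoning
      factor : ∀ a b m u → a * b + m * (a * u) ≡ a * (b + m * u)
      factor = solve-∀
      unfactor : ∀ a m u → a * (m * u) ≡ m * (a * u)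
      unfactor = solve-∀
      pointwise : ∀ x y → near x y * meet x y + n * (near x y * unset (S′ x y)) ≤ n * (near x y * unset (S x y))
      pointwise x y = ≤-trans (≤-reflexive (factor (near x y) _ n _))
        (≤-trans (*-monoʳ-≤ (near x y) (meet-unset x y)) (≤-reflexive (unfactor (near x y) n _)))

    -- The amortised account of one reordering: movement is paid by the growth of the potential and
    -- by the near pairs that `S′` newly closes.
    step : (L * sum ups + potential pos) + L * (n * openPairs S′) ≤ potential pos′ + L * (n * openPairs S)
    step = begin
      (L * sum ups + potential pos) + L * (n * openPairs S′)
        ≤⟨ +-monoˡ-≤ _ potential-step ⟩
      (potential pos′ + L * N) + L * (n * openPairs S′)
        ≡⟨ trans (+-assoc (potential pos′) _ _) (cong (potential pos′ +_) (sym (*-distribˡ-+ L N _))) ⟩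
      potential pos′ + L * (N + n * openPairs S′)
        ≤⟨ +-monoʳ-≤ (potential pos′) (*-monoʳ-≤ L meet-open) ⟩
      potential pos′ + L * (n * openPairs S) ∎
      where
      open ≤-Reasoning
      N = sum (λ x → sum (λ y → near x y * meet x y))

-- Position and vertex arrays

setV-≡ : ∀ {n} (vtx : VArr n) p m → setV vtx p m p ≡ m
setV-≡ vtx p m with p ≡ᵇ p in eq
... | true  = refl
... | false = ⊥-elim (subst T eq (≡⇒≡ᵇ p p refl))

setV-≢ : ∀ {n} (vtx : VArr n) {p q} m → q ≢ p → setV vtx p m q ≡ vtx q
setV-≢ vtx {p} {q} m q≢p with q ≡ᵇ p in eq
... | true  = contradiction (≡ᵇ⇒≡ q p (subst T (sym eq) _)) q≢p
... | false = refl

setP-≡ : ∀ {n} (pos : PArr n) x p → setP pos x p x ≡ p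
setP-≡ pos x p rewrite dec-true (x Fin.≟ x) refl = refl

setP-≢ : ∀ {n} (pos : PArr n) {x y} p → y ≢ x → setP pos x p y ≡ pos y
setP-≢ pos {x} {y} p y≢x rewrite dec-false (y Fin.≟ x) y≢x = refl

just≢nothing : ∀ {A : Set} {x : A} {m} → m ≡ just x → m ≢ nothing
just≢nothing refl ()

-- The arrays are mutually inverse except on the vertices of W, which have been
-- removed from vtx and keep their former position.
record Removed {n} (W : List (Fin n)) (vtx : VArr n) (pos : PArr n) : Set where
  field
    unique : Unique W
    pos≥1  : ∀ x → 1 ≤ pos x
    pos≤n  : ∀ x → pos x ≤ n
    held   : ∀ {p x} → vtx p ≡ just x → pos x ≡ p × x ∉ W
    placed : ∀ x → x ∈ W ⊎ vtx (pos x) ≡ just x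

  placed-∉ : ∀ {x} → x ∉ W → vtx (pos x) ≡ just x
  placed-∉ {x} x∉W with placed x
  ... | inj₁ x∈W = contradiction x∈W x∉W
  ... | inj₂ eq  = eq

open Removed

Numbering : ∀ {n} → VArr n → PArr n → Set
Numbering = Removed []

module _ {n} {vtx : VArr n} {pos : PArr n} where

  erase : ∀ {W p z} → vtx p ≡ just z → Removed W vtx pos → Removed (z ∷ W) (setV vtx p nothing) pos
  erase {W} {p} {z} vp≡z inv = record
    { unique = All.¬Any⇒All¬ W (proj₂ (held inv vp≡z)) ∷ unique inv
    ; pos≥1  = pos≥1 inv
    ; pos≤n  = pos≤n inv
    ; held   = held′
    ; placed = placed′
    }
    where
    held′ : ∀ {q x} → setV vtx p nothing q ≡ just x → pos x ≡ q × x ∉ z ∷ W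
    held′ {q} {x} eq with q ≟ p
    ... | yes refl = contradiction (setV-≡ vtx p nothing) (just≢nothing eq)
    ... | no  q≢p with held inv (trans (sym (setV-≢ vtx nothing q≢p)) eq)
    ...   | px≡q , x∉W = px≡q , λ { (here refl) → q≢p (trans (sym px≡q) (proj₁ (held inv vp≡z)))
                                  ; (there x∈W) → x∉W x∈W }
    placed′ : ∀ x → x ∈ z ∷ W ⊎ setV vtx p nothing (pos x) ≡ just x
    placed′ x with x Fin.≟ z
    ... | yes x≡z = inj₁ (here x≡z)
    ... | no  x≢z with placed inv x
    ...   | inj₁ x∈W = inj₁ (there x∈W)
    ...   | inj₂ eq  = inj₂ (trans (setV-≢ vtx nothing (λ px≡p →
                         x≢z (just-injective (trans (sym eq) (trans (cong vtx px≡p) vp≡z))))) eq)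

  fill : ∀ {W p x} → vtx p ≡ nothing → 1 ≤ p → p ≤ n → Removed (x ∷ W) vtx pos →
         Removed W (setV vtx p (just x)) (setP pos x p)
  fill {W} {p} {x} vp≡∅ 1≤p p≤n inv = record
    { unique = AllPairs.tail (unique inv)
    ; pos≥1  = λ y → bound (1 ≤_) 1≤p (pos≥1 inv) y
    ; pos≤n  = λ y → bound (_≤ n) p≤n (pos≤n inv) y
    ; held   = held′
    ; placed = placed′
    }
    where
    bound : ∀ (P : ℕ → Set) → P p → (∀ y → P (pos y)) → ∀ y → P (setP pos x p y)
    bound P Pp Ppos y with y Fin.≟ x
    ... | yes refl = Pp
    ... | no  y≢x  = Ppos y
    held′ : ∀ {q y} → setV vtx p (just x) q ≡ just y → setP pos x p y ≡ q × y ∉ W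
    held′ {q} {y} eq with q ≟ p
    ... | yes refl with just-injective (trans (sym (setV-≡ vtx p (just x))) eq)
    ...   | refl = setP-≡ pos x p , Unique.Unique[x∷xs]⇒x∉xs (unique inv)
    held′ {q} {y} eq | no q≢p with held inv (trans (sym (setV-≢ vtx (just x) q≢p)) eq)
    ... | py≡q , y∉ = trans (setP-≢ pos p (y∉ ∘ here)) py≡q , y∉ ∘ there
    placed′ : ∀ y → y ∈ W ⊎ setV vtx p (just x) (setP pos x p y) ≡ just y
    placed′ y with y Fin.≟ x
    ... | yes refl = inj₂ (setV-≡ vtx p (just x))
    ... | no  y≢x with placed inv y
    ...   | inj₁ (here y≡x)  = contradiction y≡x y≢x
    ...   | inj₁ (there y∈W) = inj₁ y∈W
    ...   | inj₂ eq = inj₂ (trans (setV-≢ vtx (just x) (λ py≡p → just≢nothing eq (trans (cong vtx py≡p) vp≡∅))) eq)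

  permute : ∀ {W W′} → W ↭ W′ → Removed W vtx pos → Removed W′ vtx pos
  permute W↭W′ inv = record
    { unique = PermS.Unique-resp-↭ (setoid (Fin n)) (↭⇒↭ₛ W↭W′) (unique inv)
    ; pos≥1  = pos≥1 inv
    ; pos≤n  = pos≤n inv
    ; held   = λ eq → proj₁ (held inv eq) , proj₂ (held inv eq) ∘ Perm.∈-resp-↭ (↭-sym W↭W′)
    ; placed = λ x → Sum.map₁ (Perm.∈-resp-↭ W↭W′) (placed inv x)
    }

  module _ (inv : Numbering vtx pos) where

    pos-injective : ∀ x y → pos x ≡ pos y → x ≡ y
    pos-injective x y eq = just-injective (trans (sym (placed-∉ inv λ ())) (trans (cong vtx eq) (placed-∉ inv λ ())))

    slot : Fin n → Fin n
    slot x = fromℕ< (≤-trans (≤-reflexive (m+[n∸m]≡n (pos≥1 inv x))) (pos≤n inv x))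

    suc-slot : ∀ x → suc (toℕ (slot x)) ≡ pos x
    suc-slot x = trans (cong suc (Fin.toℕ-fromℕ< _)) (m+[n∸m]≡n (pos≥1 inv x))

    slot-injective : ∀ x y → slot x ≡ slot y → x ≡ y
    slot-injective x y eq = pos-injective x y (trans (sym (suc-slot x)) (trans (cong (suc ∘ toℕ) eq) (suc-slot y)))

    -- A value missed by the injective map `slot` could be added to its values, giving an injection
    -- of n + 1 elements into `Fin n`.
    slot-surjective : ∀ p → ∃ λ x → slot x ≡ p
    slot-surjective p with Fin.any? (λ x → slot x Fin.≟ p)
    ... | yes found = found
    ... | no  none  = ⊥-elim (clash (Fin.pigeonhole (n<1+n n) extended))
      where
      extended : Fin (suc n) → Fin n
      extended Fin.zero    = p
      extended (Fin.suc x) = slot x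
      clash : ¬ (∃ λ i → ∃ λ j → i Fin.< j × extended i ≡ extended j)
      clash (Fin.zero  , Fin.suc y , _ , eq)   = none (y , sym eq)
      clash (Fin.suc x , Fin.suc y , x<y , eq) = <⇒≢ x<y (cong (suc ∘ toℕ) (slot-injective x y eq))

    full : ∀ {p} → 1 ≤ p → p ≤ n → ∃ λ x → vtx p ≡ just x
    full {suc p} 1≤p p<n with slot-surjective (fromℕ< p<n)
    ... | x , eq = x , trans (cong vtx (trans (cong suc (sym (trans (cong toℕ eq) (Fin.toℕ-fromℕ< p<n)))) (suc-slot x)))
                             (placed-∉ inv λ ())

    -- The positions are a permutation of 1, ..., n, so the right side does not depend on the
    -- numbering. Applied to indicators, this shows that two numberings have equally many vertices
    -- at or below every slot.
    sum-positions : ∀ (g : ℕ → ℕ) → sum (g ∘ pos) ≡ sum {n} (g ∘ suc ∘ toℕ)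
    sum-positions g = sym (trans (sum-permute (g ∘ suc ∘ toℕ) π) (sum-cong-≗ (cong g ∘ suc-slot)))
      where
      π : Permutation′ n
      π = permutation slot (proj₁ ∘ slot-surjective) (proj₂ ∘ slot-surjective)
            (λ x → slot-injective _ _ (proj₂ (slot-surjective (slot x))))

-- Reordering passes

length-∷ʳ : ∀ {A : Set} (xs : List A) x → length (xs ++ [ x ]) ≡ suc (length xs)
length-∷ʳ xs x = trans (List.length-++ xs) (+-comm (length xs) 1)

any-true : ∀ {A : Set} (f : A → Bool) xs → any f xs ≡ true → ∃ λ x → x ∈ xs × f x ≡ true
any-true f (x ∷ xs) eq with f x in fx
... | true = x , here refl , fx
... | false with any-true f xs eq
...   | y , y∈xs , fy = y , there y∈xs , fy

any-false : ∀ {A : Set} (f : A → Bool) xs → any f xs ≡ false → All (λ x → f x ≡ false) xs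
any-false f []       eq = []
any-false f (x ∷ xs) eq with f x in fx
... | false = fx ∷ any-false f xs eq

AllPairs-∈ : ∀ {A : Set} {R : A → A → Set} {xs x y} → AllPairs R xs → x ∈ xs → y ∈ xs → x ≡ y ⊎ R x y ⊎ R y x
AllPairs-∈ (Rx ∷ _)  (here refl) (here refl) = inj₁ refl
AllPairs-∈ (Rx ∷ _)  (here refl) (there y∈)  = inj₂ (inj₁ (All.lookup Rx y∈))
AllPairs-∈ (Rx ∷ _)  (there x∈)  (here refl) = inj₂ (inj₂ (All.lookup Rx x∈))
AllPairs-∈ (_ ∷ Rxs) (there x∈)  (there y∈)  = AllPairs-∈ Rxs x∈ y∈

module _ {n : ℕ} where

  nullAt : Maybe (Fin n) → ℕ
  nullAt nothing  = 1
  nullAt (just _) = 0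

  nulls : VArr n → List ℕ → ℕ
  nulls vtx []       = 0
  nulls vtx (p ∷ ps) = nullAt (vtx p) + nulls vtx ps

  -- Every null slot is weighted by its rank in ps, counted from 1.
  nullWeight : VArr n → List ℕ → ℕ
  nullWeight vtx []       = 0
  nullWeight vtx (p ∷ ps) = nulls vtx (p ∷ ps) + nullWeight vtx ps

  Agree : VArr n → VArr n → List ℕ → Set
  Agree vtx₁ vtx₂ = All (λ p → vtx₁ p ≡ vtx₂ p)

  nulls-cong : ∀ {vtx₁ vtx₂ ps} → Agree vtx₁ vtx₂ ps → nulls vtx₁ ps ≡ nulls vtx₂ ps
  nulls-cong []       = refl
  nulls-cong (e ∷ es) = cong₂ _+_ (cong nullAt e) (nulls-cong es)

  nullWeight-cong : ∀ {vtx₁ vtx₂ ps} → Agree vtx₁ vtx₂ ps → nullWeight vtx₁ ps ≡ nullWeight vtx₂ ps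
  nullWeight-cong []       = refl
  nullWeight-cong (e ∷ es) = cong₂ _+_ (nulls-cong (e ∷ es)) (nullWeight-cong es)

  contents-cong : ∀ {vtx₁ vtx₂ : VArr n} {ps} → Agree vtx₁ vtx₂ ps → mapMaybe vtx₁ ps ≡ mapMaybe vtx₂ ps
  contents-cong [] = refl
  contents-cong {vtx₁} {vtx₂} {p ∷ ps} (e ∷ es) rewrite e with vtx₂ p
  ... | just x  = cong (x ∷_) (contents-cong es)
  ... | nothing = contents-cong es

  ∈-contents : ∀ (vtx : VArr n) {ps x} → x ∈ mapMaybe vtx ps → ∃ λ p → p ∈ ps × vtx p ≡ just x
  ∈-contents vtx {p ∷ ps} x∈ with vtx p in eq
  ∈-contents vtx {p ∷ ps} x∈ | nothing with ∈-contents vtx {ps} x∈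
  ... | q , q∈ , e = q , there q∈ , e
  ∈-contents vtx {p ∷ ps} (here refl) | just z = p , here refl , eq
  ∈-contents vtx {p ∷ ps} (there x∈)  | just z with ∈-contents vtx {ps} x∈
  ... | q , q∈ , e = q , there q∈ , e

  contents-∈ : ∀ (vtx : VArr n) {ps p x} → p ∈ ps → vtx p ≡ just x → x ∈ mapMaybe vtx ps
  contents-∈ vtx {p ∷ ps} (here refl) eq rewrite eq = here refl
  contents-∈ vtx {q ∷ ps} (there p∈)  eq with vtx q
  ... | nothing = contents-∈ vtx p∈ eq
  ... | just _  = there (contents-∈ vtx p∈ eq)

  All-contents : ∀ {P : Fin n → Set} (vtx : VArr n) {ps} → All (λ p → ∀ x → vtx p ≡ just x → P x) ps →
                 All P (mapMaybe vtx ps)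
  All-contents vtx [] = []
  All-contents vtx {p ∷ ps} (h ∷ hs) with vtx p in eq
  ... | nothing = All-contents vtx hs
  ... | just x  = h x refl ∷ All-contents vtx hs

  AllPairs-contents⁺ : ∀ {R : Fin n → Fin n → Set} (vtx : VArr n) {ps} →
    AllPairs (λ p q → ∀ x y → vtx p ≡ just x → vtx q ≡ just y → R x y) ps → AllPairs R (mapMaybe vtx ps)
  AllPairs-contents⁺ vtx [] = []
  AllPairs-contents⁺ vtx {p ∷ ps} (h ∷ hs) with vtx p
  ... | nothing = AllPairs-contents⁺ vtx hs
  ... | just x  = All-contents vtx (All.map (λ f y → f x y refl) h) ∷ AllPairs-contents⁺ vtx hs

  AllPairs-contents⁻ : ∀ {R : Fin n → Fin n → Set} (vtx : VArr n) {ps} → AllPairs R (mapMaybe vtx ps) →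
    AllPairs (λ p q → ∀ x y → vtx p ≡ just x → vtx q ≡ just y → R x y) ps
  AllPairs-contents⁻ vtx {[]} _ = []
  AllPairs-contents⁻ vtx {p ∷ ps} rs with vtx p in eq
  AllPairs-contents⁻ vtx {p ∷ ps} rs       | nothing =
    All.universal (λ _ _ _ e → contradiction eq (just≢nothing e)) ps ∷ AllPairs-contents⁻ vtx rs
  AllPairs-contents⁻ {R} vtx {p ∷ ps} (r ∷ rs) | just x  =
    All.tabulate (λ q∈ _ y e e′ → subst (λ a → R a y) (just-injective (trans (sym eq) e))
                                        (All.lookup r (contents-∈ vtx q∈ e′))) ∷
    AllPairs-contents⁻ vtx rs

  Unique⇒≢ : ∀ {p : ℕ} {ps} → Unique (p ∷ ps) → All (_≢ p) ps
  Unique⇒≢ (h ∷ _) = All.map (λ p≢q → p≢q ∘ sym) h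

  setV-agree : ∀ (vtx : VArr n) {p ps} m → All (_≢ p) ps → Agree (setV vtx p m) vtx ps
  setV-agree vtx m = All.map (setV-≢ vtx m)

  reset-agree : ∀ (vtx : VArr n) {p ps} m m′ → All (_≢ p) ps → Agree (setV (setV vtx p m) p m′) vtx ps
  reset-agree vtx m m′ = All.map (λ q≢p → trans (setV-≢ (setV vtx _ m) m′ q≢p) (setV-≢ vtx m q≢p))

  module _ (E : Graph n) where

    -- A run of a reordering loop that visits the slots ps in this order, with queue Q.
    -- The forward loop is the case of increasing slots, the backward loop that of
    -- decreasing slots with all arcs reversed.
    data Pass : List ℕ → List (Fin n) → VArr n → PArr n → VArr n → PArr n → ℕ → Set where
      done : ∀ {ps vtx pos} → Pass ps [] vtx pos vtx pos 1
      hole : ∀ {p ps x Q vtx pos vtx′ pos′ c} → vtx p ≡ nothing →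
             Pass ps Q (setV vtx p (just x)) (setP pos x p) vtx′ pos′ c →
             Pass (p ∷ ps) (x ∷ Q) vtx pos vtx′ pos′ (2 + c)
      skip : ∀ {p ps x Q z vtx pos vtx′ pos′ c} → vtx p ≡ just z → any (λ u → E u z) (x ∷ Q) ≡ false →
             Pass ps (x ∷ Q) vtx pos vtx′ pos′ c →
             Pass (p ∷ ps) (x ∷ Q) vtx pos vtx′ pos′ (3 + length Q + c)
      push : ∀ {p ps x Q z vtx pos vtx′ pos′ c} → vtx p ≡ just z → any (λ u → E u z) (x ∷ Q) ≡ true →
             Pass ps (Q ++ [ z ]) (setV (setV vtx p nothing) p (just x)) (setP pos x p) vtx′ pos′ c →
             Pass (p ∷ ps) (x ∷ Q) vtx pos vtx′ pos′ (3 + length Q + c)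

    pass-outside : ∀ {ps Q vtx pos vtx′ pos′ c} → Pass ps Q vtx pos vtx′ pos′ c →
                   ∀ {q} → q ∉ ps → vtx′ q ≡ vtx q
    pass-outside done q∉ = refl
    pass-outside (hole {vtx = vtx} _ t) q∉ =
      trans (pass-outside t (q∉ ∘ there)) (setV-≢ vtx _ (q∉ ∘ here))
    pass-outside (skip _ _ t) q∉ = pass-outside t (q∉ ∘ there)
    pass-outside (push {p = p} {vtx = vtx} _ _ t) q∉ =
      trans (pass-outside t (q∉ ∘ there))
        (trans (setV-≢ (setV vtx p nothing) _ (q∉ ∘ here)) (setV-≢ vtx nothing (q∉ ∘ here)))

    pass-head : ∀ {p ps Q vtx pos vtx′ pos′ c x} → Unique (p ∷ ps) → Pass ps Q vtx pos vtx′ pos′ c →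
                vtx p ≡ just x → vtx′ p ≡ just x
    pass-head uniq t eq = trans (pass-outside t (Unique.Unique[x∷xs]⇒x∉xs uniq)) eq

    -- The queue is always as long as the number of null slots still ahead. A visit with l + 1
    -- queued vertices costs at most 3 + l ≤ 3 (l + 1), hence three times that number; the sum over
    -- all visits counts each null slot once per visit up to its own, which is its rank.
    pass-cost : ∀ {ps Q vtx pos vtx′ pos′ c} → Pass ps Q vtx pos vtx′ pos′ c →
                Unique ps → nulls vtx ps ≡ length Q → c ≤ 1 + 3 * nullWeight vtx ps
    pass-cost done uniq _ = s≤s z≤n
    pass-cost {p ∷ ps} {x ∷ Q} {vtx} (hole {c = c} vp t) uniq@(_ ∷ uniq′) eq = begin
      2 + c                                                        ≤⟨ +-monoʳ-≤ 2 (pass-cost t uniq′ eq′) ⟩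
      2 + (1 + 3 * nullWeight (setV vtx p (just x)) ps)            ≡⟨ cong (λ w → 2 + (1 + 3 * w)) (nullWeight-cong (setV-agree vtx _ (Unique⇒≢ uniq))) ⟩
      2 + (1 + 3 * w)                                              ≤⟨ m≤m+n _ (1 + 3 * length Q) ⟩
      2 + (1 + 3 * w) + (1 + 3 * length Q)                         ≡⟨ arith w (length Q) ⟩
      1 + 3 * (suc (length Q) + w)                                 ≡⟨ cong (λ m → 1 + 3 * (m + w)) eq ⟨
      1 + 3 * nullWeight vtx (p ∷ ps)                              ∎
      where
      open ≤-Reasoning
      w = nullWeight vtx ps
      arith : ∀ w l → 2 + (1 + 3 * w) + (1 + 3 * l) ≡ 1 + 3 * (suc l + w)
      arith = solve-∀
      eq′ : nulls (setV vtx p (just x)) ps ≡ length Q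
      eq′ = trans (nulls-cong (setV-agree vtx _ (Unique⇒≢ uniq)))
                  (suc-injective (trans (cong (λ m → nullAt m + nulls vtx ps) (sym vp)) eq))
    pass-cost {p ∷ ps} {x ∷ Q} {vtx} (skip {c = c} vp _ t) (_ ∷ uniq) eq = begin
      3 + length Q + c                                ≤⟨ +-monoʳ-≤ (3 + length Q) (pass-cost t uniq (trans (cong (λ m → nullAt m + nulls vtx ps) (sym vp)) eq)) ⟩
      3 + length Q + (1 + 3 * w)                      ≤⟨ m≤m+n _ (2 * length Q) ⟩
      3 + length Q + (1 + 3 * w) + 2 * length Q       ≡⟨ arith w (length Q) ⟩
      1 + 3 * (suc (length Q) + w)                    ≡⟨ cong (λ m → 1 + 3 * (m + w)) eq ⟨
      1 + 3 * nullWeight vtx (p ∷ ps)                 ∎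
      where
      open ≤-Reasoning
      w = nullWeight vtx ps
      arith : ∀ w l → 3 + l + (1 + 3 * w) + 2 * l ≡ 1 + 3 * (suc l + w)
      arith = solve-∀
    pass-cost {p ∷ ps} {x ∷ Q} {vtx} (push {z = z} {c = c} vp _ t) uniq@(_ ∷ uniq′) eq = begin
      3 + length Q + c                                ≤⟨ +-monoʳ-≤ (3 + length Q) (pass-cost t uniq′ eq′) ⟩
      3 + length Q + (1 + 3 * nullWeight (setV (setV vtx p nothing) p (just x)) ps)
                                                      ≡⟨ cong (λ w → 3 + length Q + (1 + 3 * w)) (nullWeight-cong agree) ⟩
      3 + length Q + (1 + 3 * w)                      ≤⟨ m≤m+n _ (2 * length Q) ⟩
      3 + length Q + (1 + 3 * w) + 2 * length Q       ≡⟨ arith w (length Q) ⟩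
      1 + 3 * (suc (length Q) + w)                    ≡⟨ cong (λ m → 1 + 3 * (m + w)) eq ⟨
      1 + 3 * nullWeight vtx (p ∷ ps)                 ∎
      where
      open ≤-Reasoning
      w = nullWeight vtx ps
      agree = reset-agree vtx nothing (just x) (Unique⇒≢ uniq)
      arith : ∀ w l → 3 + l + (1 + 3 * w) + 2 * l ≡ 1 + 3 * (suc l + w)
      arith = solve-∀
      eq′ : nulls (setV (setV vtx p nothing) p (just x)) ps ≡ length (Q ++ [ z ])
      eq′ = trans (nulls-cong agree) (trans (trans (cong (λ m → nullAt m + nulls vtx ps) (sym vp)) eq)
              (sym (length-∷ʳ Q z)))

    pass-removed : ∀ {R ps Q vtx pos vtx′ pos′ c} → Pass ps Q vtx pos vtx′ pos′ c →
                   All (λ p → 1 ≤ p × p ≤ n) ps → Removed (Q ++ R) vtx pos → Removed R vtx′ pos′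
    pass-removed done         _                      inv = inv
    pass-removed (hole vp t)  ((1≤p , p≤n) ∷ bounds) inv = pass-removed t bounds (fill vp 1≤p p≤n inv)
    pass-removed (skip _ _ t) (_ ∷ bounds)           inv = pass-removed t bounds inv
    pass-removed {R} (push {p} {x = x} {Q} {z} {vtx} vp _ t) ((1≤p , p≤n) ∷ bounds) inv =
      pass-removed t bounds (fill (setV-≡ vtx p nothing) 1≤p p≤n (permute reorder (erase vp inv)))
      where
      reorder : z ∷ x ∷ Q ++ R ↭ x ∷ (Q ++ [ z ]) ++ R
      reorder = ↭-trans (swap z x ↭-refl)
        (prep x (subst (z ∷ Q ++ R ↭_) (sym (List.++-assoc Q [ z ] R)) (↭-sym (Perm.shift z Q R))))

    pass-contents : ∀ {ps Q vtx pos vtx′ pos′ c} → Pass ps Q vtx pos vtx′ pos′ c → Unique ps →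
                    mapMaybe vtx′ ps ↭ Q ++ mapMaybe vtx ps
    pass-contents done uniq = ↭-refl
    pass-contents {p ∷ ps} {x ∷ Q} {vtx} (hole vp t) uniq@(_ ∷ uniq′)
      rewrite pass-head uniq t (setV-≡ vtx p (just x)) | vp =
      prep x (subst (λ cs → _ ↭ Q ++ cs) (contents-cong (setV-agree vtx _ (Unique⇒≢ uniq))) (pass-contents t uniq′))
    pass-contents {p ∷ ps} {x ∷ Q} {vtx} (skip {z = z} vp _ t) uniq@(_ ∷ uniq′)
      rewrite pass-head uniq t vp | vp =
      ↭-trans (prep z (pass-contents t uniq′)) (↭-sym (Perm.shift z (x ∷ Q) _))
    pass-contents {p ∷ ps} {x ∷ Q} {vtx} (push {z = z} vp _ t) uniq@(_ ∷ uniq′)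
      rewrite pass-head uniq t (setV-≡ (setV vtx p nothing) p (just x)) | vp =
      prep x (subst (_ ↭_) (trans (List.++-assoc Q [ z ] _)
        (cong (λ cs → Q ++ z ∷ cs) (contents-cong (reset-agree vtx _ _ (Unique⇒≢ uniq))))) (pass-contents t uniq′))

    NoBackArc : Fin n → Fin n → Set
    NoBackArc x y = E y x ≡ false

    -- An overtaken vertex has no arc from the queue, and an inserted one joins its end.
    pass-order : ∀ {ps Q vtx pos vtx′ pos′ c} → Pass ps Q vtx pos vtx′ pos′ c → Unique ps →
                 AllPairs NoBackArc (Q ++ mapMaybe vtx ps) → AllPairs NoBackArc (mapMaybe vtx′ ps)
    pass-order done uniq ord = ord
    pass-order {p ∷ ps} {x ∷ Q} {vtx} (hole vp t) uniq@(_ ∷ uniq′) ord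
      rewrite pass-head uniq t (setV-≡ vtx p (just x)) | vp
      with r ∷ rs ← ord =
      Perm.All-resp-↭ (↭-sym (pass-contents t uniq′)) (subst (All _) same r) ∷
      pass-order t uniq′ (subst (AllPairs NoBackArc) same rs)
      where same = cong (Q ++_) (sym (contents-cong (setV-agree vtx (just x) (Unique⇒≢ uniq))))
    pass-order {p ∷ ps} {x ∷ Q} {vtx} (skip {z = z} vp none t) uniq@(_ ∷ uniq′) ord
      rewrite pass-head uniq t vp | vp =
      Perm.All-resp-↭ (↭-sym (pass-contents t uniq′)) (All.++⁺ (any-false (λ u → E u z) (x ∷ Q) none) (proj₁ (delete (x ∷ Q) ord))) ∷
      pass-order t uniq′ (proj₂ (delete (x ∷ Q) ord))
      where
      delete : ∀ xs {ys} → AllPairs NoBackArc (xs ++ z ∷ ys) → All (NoBackArc z) ys × AllPairs NoBackArc (xs ++ ys)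
      delete []       (r ∷ rs) = r , rs
      delete (a ∷ as) (r ∷ rs) with All.++⁻ as r
      ... | r₁ , _ ∷ r₂ = proj₁ (delete as rs) , All.++⁺ r₁ r₂ ∷ proj₂ (delete as rs)
    pass-order {p ∷ ps} {x ∷ Q} {vtx} (push {z = z} vp _ t) uniq@(_ ∷ uniq′) ord
      rewrite pass-head uniq t (setV-≡ (setV vtx p nothing) p (just x)) | vp
      with r ∷ rs ← ord =
      Perm.All-resp-↭ (↭-sym (pass-contents t uniq′)) (subst (All _) same r) ∷
      pass-order t uniq′ (subst (AllPairs NoBackArc) same rs)
      where
      same = trans (cong (λ cs → Q ++ z ∷ cs) (sym (contents-cong (reset-agree vtx nothing (just x) (Unique⇒≢ uniq)))))
                   (sym (List.++-assoc Q [ z ] _))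

    module _ (Reached : Fin n → Set) (closed : ∀ {u z} → Reached u → E u z ≡ true → Reached z)
             (_≼_ : ℕ → ℕ → Set) (≼-refl : ∀ p → p ≼ p) (base : PArr n) where

      -- A vertex not yet visited sits in its slot of `base`; a queued vertex is reached and all
      -- remaining slots lie on the correct side of its slot. Both persist: a pushed vertex is
      -- reached by an arc from the queue, and its slot p precedes the remaining ones.
      pass-moves : ∀ {ps Q vtx pos vtx′ pos′ c} → Pass ps Q vtx pos vtx′ pos′ c → Unique ps → AllPairs _≼_ ps →
                   All (λ p → ∀ x → vtx p ≡ just x → base x ≡ p) ps →
                   All (λ x → Reached x × All (base x ≼_) ps) Q →
                   All (λ p → ∀ x → vtx′ p ≡ just x → base x ≡ p ⊎ (Reached x × base x ≼ p)) ps
      pass-moves done uniq inc home queue = All.map (λ h x → inj₁ ∘ h x) home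
      pass-moves {p ∷ ps} {x ∷ Q} {vtx} (hole vp t) uniq@(_ ∷ uniq′) (_ ∷ inc) (_ ∷ home) ((rx , x≼p ∷ _) ∷ queue) =
        (λ _ e → subst (λ y → base y ≡ p ⊎ (Reached y × base y ≼ p))
                 (just-injective (trans (sym (pass-head uniq t (setV-≡ vtx p (just x)))) e)) (inj₂ (rx , x≼p))) ∷
        pass-moves t uniq′ inc (All.zipWith (λ (e , h) y → h y ∘ trans (sym e)) (setV-agree vtx _ (Unique⇒≢ uniq) , home))
          (All.map (λ (r , a) → r , All.tail a) queue)
      pass-moves {p ∷ ps} {x ∷ Q} {vtx} (skip vp _ t) uniq@(_ ∷ uniq′) (_ ∷ inc) (hp ∷ home) queue =
        (λ y e → inj₁ (hp y (trans vp (trans (sym (pass-head uniq t vp)) e)))) ∷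
        pass-moves t uniq′ inc home (All.map (λ (r , a) → r , All.tail a) queue)
      pass-moves {p ∷ ps} {x ∷ Q} {vtx} (push {z = z} vp arc t) uniq@(_ ∷ uniq′) (p≼ ∷ inc) (hp ∷ home) queue@((rx , x≼p ∷ _) ∷ _) =
        (λ _ e → subst (λ y → base y ≡ p ⊎ (Reached y × base y ≼ p))
                 (just-injective (trans (sym (pass-head uniq t (setV-≡ (setV vtx p nothing) p (just x)))) e)) (inj₂ (rx , x≼p))) ∷
        pass-moves t uniq′ inc (All.zipWith (λ (e , h) y → h y ∘ trans (sym e)) (reset-agree vtx _ _ (Unique⇒≢ uniq) , home))
          (All.++⁺ (All.map (λ (r , a) → r , All.tail a) (All.tail queue))
                   ((reached-z , subst (λ b → All (b ≼_) ps) (sym (hp z vp)) p≼) ∷ []))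
        where
        reached-z : Reached z
        reached-z with any-true (λ u → E u z) (x ∷ Q) arc
        ... | u , u∈ , uz = closed (proj₁ (All.lookup queue u∈)) uz

upward-≥ : ∀ i m → All (i ≤_) (iterate suc i m)
upward-≥ i zero    = []
upward-≥ i (suc m) = ≤-refl ∷ All.map <⇒≤ (upward-≥ (suc i) m)

upward-< : ∀ i m → All (_< i + m) (iterate suc i m)
upward-< i zero    = []
upward-< i (suc m) = subst (i <_) (sym (+-suc i m)) (s≤s (m≤m+n i m)) ∷
  All.map (λ {p} → subst (p <_) (sym (+-suc i m))) (upward-< (suc i) m)

upward-increasing : ∀ i m → AllPairs _<_ (iterate suc i m)
upward-increasing i zero    = []
upward-increasing i (suc m) = upward-≥ (suc i) m ∷ upward-increasing (suc i) m

upward-∈ : ∀ i m {p} → i ≤ p → p < i + m → p ∈ iterate suc i m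
upward-∈ i zero    i≤p p<i = contradiction (subst (_ <_) (+-identityʳ i) p<i) (≤⇒≯ i≤p)
upward-∈ i (suc m) {p} i≤p p<i+m with i ≟ p
... | yes i≡p = here (sym i≡p)
... | no  i≢p = there (upward-∈ (suc i) m (≤∧≢⇒< i≤p i≢p) (subst (p <_) (+-suc i m) p<i+m))

downward-≤ : ∀ i m → All (_≤ i) (iterate pred i m)
downward-≤ i zero    = []
downward-≤ i (suc m) = ≤-refl ∷ All.map (λ p≤ → ≤-trans p≤ pred[n]≤n) (downward-≤ (pred i) m)

downward-≥1 : ∀ i m → m ≤ i → All (1 ≤_) (iterate pred i m)
downward-≥1 i       zero    _         = []
downward-≥1 (suc i) (suc m) (s≤s m≤i) = s≤s z≤n ∷ downward-≥1 i m m≤i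

downward-decreasing : ∀ i m → m ≤ i → AllPairs _>_ (iterate pred i m)
downward-decreasing i       zero    _         = []
downward-decreasing (suc i) (suc m) (s≤s m≤i) = All.map s≤s (downward-≤ i m) ∷ downward-decreasing i m m≤i

downward-∈ : ∀ i {p} → 1 ≤ p → p ≤ i → p ∈ iterate pred i i
downward-∈ zero    1≤p p≤0 = contradiction (≤-trans 1≤p p≤0) λ ()
downward-∈ (suc i) {p} 1≤p p≤1+i with p ≟ suc i
... | yes p≡1+i = here p≡1+i
... | no  p≢1+i = there (downward-∈ i 1≤p (s≤s⁻¹ (≤∧≢⇒< p≤1+i p≢1+i)))

module _ {n} (G : Graph n) where

  reorderF-pass : ∀ k m Q i (vtx : VArr n) pos c → m < k → nulls vtx (iterate suc i m) ≡ length Q →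
    let r = reorderF k G (rst Q i vtx pos c) in
    ∃ λ c′ → Pass G (iterate suc i m) Q vtx pos (ReState.rvtx r) (ReState.rpos r) c′ × ReState.rcost r ≡ c + c′
  reorderF-pass (suc k) m [] i vtx pos c _ _ = 1 , done , +-comm 1 c
  reorderF-pass (suc k) (suc m) (x ∷ Q) i vtx pos c (s≤s m<k) eq with vtx i in vi
  ... | nothing rewrite vi with reorderF-pass k m Q (suc i) (setV vtx i (just x)) (setP pos x i) (suc (c + 1)) m<k
                       (trans (nulls-cong (setV-agree vtx _ (All.map (λ i<p → <⇒≢ i<p ∘ sym) (upward-≥ (suc i) m)))) (suc-injective eq))
  ...   | c′ , t , cost≡ = 2 + c′ , hole vi t , trans cost≡ (arith c c′)
    where
    arith : ∀ a b → suc (a + 1) + b ≡ a + (2 + b)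
    arith = solve-∀
  reorderF-pass (suc k) (suc m) (x ∷ Q) i vtx pos c (s≤s m<k) eq | just z with arcFrom G (x ∷ Q) z in arc
  ... | true rewrite setV-≡ vtx i nothing
    with reorderF-pass k m (Q ++ [ z ]) (suc i) (setV (setV vtx i nothing) i (just x)) (setP pos x i) (suc (c + suc (suc (length Q)))) m<k
           (trans (nulls-cong (reset-agree vtx nothing (just x) (All.map (λ i<p → <⇒≢ i<p ∘ sym) (upward-≥ (suc i) m))))
             (trans eq (sym (length-∷ʳ Q z))))
  ...   | c′ , t , cost≡ = 3 + length Q + c′ , push vi arc t , trans cost≡ (arith c (length Q) c′)
    where
    arith : ∀ a l b → suc (a + suc (suc l)) + b ≡ a + (3 + l + b)
    arith = solve-∀
  reorderF-pass (suc k) (suc m) (x ∷ Q) i vtx pos c (s≤s m<k) eq | just z | false rewrite vi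
    with reorderF-pass k m (x ∷ Q) (suc i) vtx pos (suc (c + suc (suc (length Q)))) m<k eq
  ... | c′ , t , cost≡ = 3 + length Q + c′ , skip vi arc t , trans cost≡ (arith c (length Q) c′)
    where
    arith : ∀ a l b → suc (a + suc (suc l)) + b ≡ a + (3 + l + b)
    arith = solve-∀

  reorderB-pass : ∀ k m Q j (vtx : VArr n) pos c → m < k → m ≤ pred j → nulls vtx (iterate pred (pred j) m) ≡ length Q →
    let r = reorderB k G (rst Q j vtx pos c) in
    ∃ λ c′ → Pass (flip G) (iterate pred (pred j) m) Q vtx pos (ReState.rvtx r) (ReState.rpos r) c′ × ReState.rcost r ≡ c + c′
  reorderB-pass (suc k) m [] j vtx pos c _ _ _ = 1 , done , +-comm 1 c
  reorderB-pass (suc k) (suc m) (x ∷ Q) (suc (suc j)) vtx pos c (s≤s m<k) (s≤s m≤j) eq with vtx (suc j) in vj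
  ... | nothing rewrite vj with reorderB-pass k m Q (suc j) (setV vtx (suc j) (just x)) (setP pos x (suc j)) (suc (c + 1)) m<k m≤j
                       (trans (nulls-cong (setV-agree vtx _ (All.map (λ p≤j → <⇒≢ (s≤s p≤j)) (downward-≤ j m)))) (suc-injective eq))
  ...   | c′ , t , cost≡ = 2 + c′ , hole vj t , trans cost≡ (arith c c′)
    where
    arith : ∀ a b → suc (a + 1) + b ≡ a + (2 + b)
    arith = solve-∀
  reorderB-pass (suc k) (suc m) (x ∷ Q) (suc (suc j)) vtx pos c (s≤s m<k) (s≤s m≤j) eq | just z with arcTo G z (x ∷ Q) in arc
  ... | true rewrite setV-≡ vtx (suc j) nothing
    with reorderB-pass k m (Q ++ [ z ]) (suc j) (setV (setV vtx (suc j) nothing) (suc j) (just x)) (setP pos x (suc j))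
           (suc (c + suc (suc (length Q)))) m<k m≤j
           (trans (nulls-cong (reset-agree vtx nothing (just x) (All.map (λ p≤j → <⇒≢ (s≤s p≤j)) (downward-≤ j m))))
             (trans eq (sym (length-∷ʳ Q z))))
  ...   | c′ , t , cost≡ = 3 + length Q + c′ , push vj arc t , trans cost≡ (arith c (length Q) c′)
    where
    arith : ∀ a l b → suc (a + suc (suc l)) + b ≡ a + (3 + l + b)
    arith = solve-∀
  reorderB-pass (suc k) (suc m) (x ∷ Q) (suc (suc j)) vtx pos c (s≤s m<k) (s≤s m≤j) eq | just z | false rewrite vj
    with reorderB-pass k m (x ∷ Q) (suc j) vtx pos (suc (c + suc (suc (length Q)))) m<k m≤j eq
  ... | c′ , t , cost≡ = 3 + length Q + c′ , skip vj arc t , trans cost≡ (arith c (length Q) c′)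
    where
    arith : ∀ a l b → suc (a + suc (suc l)) + b ≡ a + (3 + l + b)
    arith = solve-∀

-- The two-way search

∈⇒1≤length : ∀ {A : Set} {x : A} {Q} → x ∈ Q → 1 ≤ length Q
∈⇒1≤length (here _)  = s≤s z≤n
∈⇒1≤length (there _) = s≤s z≤n

module _ {n} (key : Fin n → ℕ) where

  -- The sum of the distances from the collected vertices to the scan frontier k.
  spread : ℕ → List (Fin n) → ℕ
  spread k Q = sumₗ (map (λ u → k ∸ key u) Q)

  spread-suc : ∀ {k Q} → All (λ u → key u < k) Q → spread (suc k) Q ≡ length Q + spread k Q
  spread-suc [] = refl
  spread-suc {k} {u ∷ Q} (u<k ∷ below) = begin
    (suc k ∸ key u) + spread (suc k) Q             ≡⟨ cong₂ _+_ (+-∸-assoc 1 (<⇒≤ u<k)) (spread-suc below) ⟩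
    suc (k ∸ key u) + (length Q + spread k Q)      ≡⟨ arith (k ∸ key u) (length Q) (spread k Q) ⟩
    suc (length Q) + ((k ∸ key u) + spread k Q)    ∎
    where
    open ≡-Reasoning
    arith : ∀ a b c → suc a + (b + c) ≡ suc b + (a + c)
    arith = solve-∀

  spread-∷ʳ : ∀ {k} Q z → key z ≡ k → spread (suc k) (Q ++ [ z ]) ≡ suc (spread (suc k) Q)
  spread-∷ʳ []      z refl = trans (+-identityʳ _) (trans (+-∸-assoc 1 (≤-refl {key z})) (cong suc (n∸n≡0 (key z))))
  spread-∷ʳ {k} (u ∷ Q) z eq = trans (cong (suc k ∸ key u +_) (spread-∷ʳ Q z eq)) (+-suc _ _)

module _ {n} (E : Graph n) (pos : PArr n) (key : Fin n → ℕ) (w : Fin n) (rest : List ℕ) where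

  -- One side of the search: the scan has visited the vertices of keys key w, …, k − 1
  -- and collected Q; its slots, the last one first, precede those of rest.
  -- The forward side uses the position as key, the backward side reverses all arcs
  -- and counts positions down from n.
  data Half : ℕ → List ℕ → List (Fin n) → ℕ → Set where
    seed : Half (suc (key w)) (pos w ∷ rest) [ w ] 0
    skip  : ∀ {k ps Q c} z → key z ≡ k → any (λ u → E u z) Q ≡ false → Half k ps Q c →
            Half (suc k) (pos z ∷ ps) Q (c + suc (length Q))
    take  : ∀ {k ps Q c} z → key z ≡ k → any (λ u → E u z) Q ≡ true → Half k ps Q c →
            Half (suc k) (pos z ∷ ps) (Q ++ [ z ]) (c + suc (length Q))

  half-keys : ∀ {k ps Q c} → Half k ps Q c → All (λ u → key u < k) Q
  half-keys seed           = ≤-refl ∷ []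
  half-keys (skip _ _ _ h)  = All.map m<n⇒m<1+n (half-keys h)
  half-keys (take _ eq _ h) = All.++⁺ (All.map m<n⇒m<1+n (half-keys h)) (s≤s (≤-reflexive eq) ∷ [])

  half-∋ : ∀ {k ps Q c} → Half k ps Q c → w ∈ Q
  half-∋ seed          = here refl
  half-∋ (skip _ _ _ h) = half-∋ h
  half-∋ (take _ _ _ h) = ∈-++⁺ˡ (half-∋ h)

  half-increasing : ∀ {k ps Q c} → Half k ps Q c → AllPairs (λ x y → key x < key y) Q
  half-increasing seed           = [] ∷ []
  half-increasing (skip _ _ _ h)  = half-increasing h
  half-increasing (take _ eq _ h) = AllPairs.++⁺ (half-increasing h) ([] ∷ [])
    (All.map (λ u<k → subst (_ <_) (sym eq) u<k ∷ []) (half-keys h))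

  half-≥seed : ∀ {k ps Q c} → Half k ps Q c → key w < k × All (λ u → key w ≤ key u) Q
  half-≥seed seed           = ≤-refl , ≤-refl ∷ []
  half-≥seed (skip _ _ _ h)  = m<n⇒m<1+n (proj₁ (half-≥seed h)) , proj₂ (half-≥seed h)
  half-≥seed (take _ eq _ h) = m<n⇒m<1+n (proj₁ (half-≥seed h)) ,
    All.++⁺ (proj₂ (half-≥seed h)) (<⇒≤ (subst (key w <_) (sym eq) (proj₁ (half-≥seed h))) ∷ [])

  half-reached : ∀ (Reached : Fin n → Set) → (∀ {u z} → Reached u → E u z ≡ true → Reached z) → Reached w →
                 ∀ {k ps Q c} → Half k ps Q c → All Reached Q
  half-reached R closed rw seed          = rw ∷ []
  half-reached R closed rw (skip _ _ _ h) = half-reached R closed rw h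
  half-reached R closed rw (take {Q = Q} z _ arc h) with any-true (λ u → E u z) Q arc
  ... | u , u∈ , uz = All.++⁺ (half-reached R closed rw h)
                        (closed (All.lookup (half-reached R closed rw h) u∈) uz ∷ [])

  -- Advancing the frontier by one raises every distance in `spread` by one, that is by |Q| in
  -- total, while the test costs 1 + |Q| ≤ 2 |Q| since w is in Q.
  half-cost : ∀ {k ps Q c} → Half k ps Q c → c ≤ 2 * spread key k Q
  half-cost seed = z≤n
  half-cost (skip {k} {Q = Q} {c} z eq _ h) = begin
    c + suc (length Q)                        ≤⟨ +-mono-≤ (half-cost h) (+-monoˡ-≤ (length Q) (∈⇒1≤length (half-∋ h))) ⟩
    2 * spread key k Q + (length Q + length Q)    ≡⟨ arith (spread key k Q) (length Q) ⟩
    2 * (length Q + spread key k Q)               ≡⟨ cong (2 *_) (spread-suc key (half-keys h)) ⟨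
    2 * spread key (suc k) Q                      ∎
    where
    open ≤-Reasoning
    arith : ∀ a b → 2 * a + (b + b) ≡ 2 * (b + a)
    arith = solve-∀
  half-cost (take {k} {Q = Q} {c} z eq _ h) = begin
    c + suc (length Q)                        ≤⟨ +-monoˡ-≤ _ (half-cost h) ⟩
    2 * spread key k Q + suc (length Q)           ≤⟨ m≤m+n _ (suc (length Q)) ⟩
    2 * spread key k Q + suc (length Q) + suc (length Q) ≡⟨ arith (spread key k Q) (length Q) ⟩
    2 * suc (length Q + spread key k Q)           ≡⟨ cong (λ a → 2 * suc a) (spread-suc key (half-keys h)) ⟨
    2 * suc (spread key (suc k) Q)                ≡⟨ cong (2 *_) (spread-∷ʳ key Q z eq) ⟨
    2 * spread key (suc k) (Q ++ [ z ])           ∎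
    where
    open ≤-Reasoning
    arith : ∀ a b → 2 * a + suc b + suc b ≡ 2 * suc (b + a)
    arith = solve-∀

  module _ {vtx : VArr n} (rest-held : nulls vtx rest ≡ 0) where

    no-nulls : ∀ ps → nulls vtx ps ≡ 0 → nullWeight vtx ps ≡ 0
    no-nulls []       _  = refl
    no-nulls (p ∷ ps) eq = cong₂ _+_ eq (no-nulls ps (m+n≡0⇒n≡0 (nullAt (vtx p)) eq))

    -- The null slots of this side are exactly those of Q, and the slot of u has rank k - `key u`
    -- because the slots are listed from the frontier backwards. This identifies the cost measure of
    -- the reordering with that of the search.
    half-nulls : ∀ {k ps Q c} → Half k ps Q c → All (λ u → vtx (pos u) ≡ nothing) Q →
                 (∀ z → key z < k → z ∉ Q → nullAt (vtx (pos z)) ≡ 0) →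
                 nulls vtx ps ≡ length Q × nullWeight vtx ps ≡ spread key k Q
    half-nulls seed (∅ ∷ []) _ = one , trans (cong₂ _+_ one (no-nulls rest rest-held)) (sym (spread-∷ʳ key [] w refl))
      where
      one : nulls vtx (pos w ∷ rest) ≡ 1
      one = cong₂ _+_ (cong nullAt ∅) rest-held
    half-nulls (skip {k} {ps} {Q} z eq _ h) gone other
      with half-nulls h gone (λ y y<k → other y (m<n⇒m<1+n y<k))
    ... | count , weight = count′ , trans (cong₂ _+_ count′ weight) (sym (spread-suc key (half-keys h)))
      where
      z∉Q : z ∉ Q
      z∉Q z∈Q = <⇒≢ (All.lookup (half-keys h) z∈Q) eq
      count′ : nulls vtx (pos z ∷ ps) ≡ length Q
      count′ = cong₂ _+_ (other z (s≤s (≤-reflexive eq)) z∉Q) count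
    half-nulls (take {k} {ps} {Q} z eq _ h) gone other
      with All.++⁻ Q gone
    ... | gone₁ , ∅ ∷ []
      with half-nulls h gone₁ (λ y y<k y∉Q → other y (m<n⇒m<1+n y<k)
             (λ y∈ → Sum.[ y∉Q , (λ { (here refl) → <⇒≢ y<k eq }) ]′ (∈-++⁻ Q y∈)))
    ... | count , weight = count′ , (begin
      nulls vtx (pos z ∷ ps) + nullWeight vtx ps ≡⟨ cong₂ _+_ (cong₂ _+_ (cong nullAt ∅) count) weight ⟩
      suc (length Q + spread key k Q)                ≡⟨ cong suc (spread-suc key (half-keys h)) ⟨
      suc (spread key (suc k) Q)                     ≡⟨ spread-∷ʳ key Q z eq ⟨
      spread key (suc k) (Q ++ [ z ])                ∎)
      where
      open ≡-Reasoning
      count′ : nulls vtx (pos z ∷ ps) ≡ length (Q ++ [ z ])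
      count′ = trans (cong₂ _+_ (cong nullAt ∅) count) (sym (length-∷ʳ Q z))

  module _ (key-injective : ∀ x y → key x ≡ key y → x ≡ y)
           (forward : ∀ {u z} → E u z ≡ true → z ≡ w ⊎ key u < key z) where

    -- A vertex is skipped on account of the queue at that moment only. Later members of Q have
    -- larger keys, and an arc that does not end in w leads to a larger key, so they have no arc to
    -- a skipped vertex.
    half-complete : ∀ {k ps Q c} → Half k ps Q c → ∀ z → key z < k → z ∈ Q ⊎ All (λ u → E u z ≡ false) Q
    half-complete seed z z<k with E w z in wz
    ... | false = inj₂ (wz ∷ [])
    ... | true with forward wz
    ...   | inj₁ z≡w = inj₁ (here z≡w)
    ...   | inj₂ w<z = contradiction w<z (≤⇒≯ (s≤s⁻¹ z<k))
    half-complete (skip {k} {Q = Q} y eq none h) z z<1+k with key z ≟ k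
    ... | no  z≢k = half-complete h z (≤∧≢⇒< (s≤s⁻¹ z<1+k) z≢k)
    ... | yes z≡k with key-injective z y (trans z≡k (sym eq))
    ...   | refl = inj₂ (any-false (λ u → E u z) Q none)
    half-complete (take {k} {Q = Q} y eq _ h) z z<1+k with key z ≟ k
    ... | yes z≡k = inj₁ (∈-++⁺ʳ Q (here (key-injective z y (trans z≡k (sym eq)))))
    ... | no  z≢k with half-complete h z (≤∧≢⇒< (s≤s⁻¹ z<1+k) z≢k)
    ...   | inj₁ z∈Q = inj₁ (∈-++⁺ˡ z∈Q)
    ...   | inj₂ none with E y z in yz
    ...     | false = inj₂ (All.++⁺ none (yz ∷ []))
    ...     | true with forward yz
    ...       | inj₁ refl = inj₁ (∈-++⁺ˡ (half-∋ h))
    ...       | inj₂ y<z  = contradiction (s≤s⁻¹ z<1+k) (<⇒≱ (subst (_< key z) eq y<z))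

module Search {n} (G : Graph n) (pos : PArr n) (vtx₀ : VArr n) (inv₀ : Numbering vtx₀ pos) (v w : Fin n) where

  -- The slots i - 1, ..., 1 and j, ..., n, each in the order in which the reordering loop visits
  -- them and in reverse of the order in which the search scanned them.
  below from : ℕ → List ℕ
  below i = iterate pred (pred i) (pred i)
  from j = iterate suc j (suc n ∸ j)

  fromTop : Fin n → ℕ
  fromTop x = n ∸ pos x

  Forward Backward : ℕ → List ℕ → List (Fin n) → ℕ → Set
  Forward  = Half G pos pos w (below (pos w))
  Backward = Half (flip G) pos fromTop v (from (suc (pos v)))

  below-suc : ∀ {i} → 1 ≤ i → below (suc i) ≡ i ∷ below i
  below-suc {suc i} _ = refl

  from-step : ∀ {j} → j ≤ n → from j ≡ j ∷ from (suc j)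
  from-step j≤n rewrite +-∸-assoc 1 j≤n = refl

  -- The scans have visited exactly the slots pos w, …, i − 1 and j, …, pos v.
  record Scanned (i j : ℕ) (F B : List (Fin n)) (vtx : VArr n) (c : ℕ) : Set where
    field
      {costF costB} : ℕ
      forward  : Forward i (below i) F costF
      backward : Backward (suc n ∸ j) (from j) B costB
      cost     : c ≡ 1 + costF + costB
      removed  : Removed (F ++ B) vtx pos
      product  : length F * length B ≤ c
      i≥1      : 1 ≤ i
      j≤1+n    : j ≤ suc n

    F-below : ∀ {u} → u ∈ F → pos u < i
    F-below = All.lookup (half-keys _ _ _ _ _ forward)

    B-above : ∀ {u} → u ∈ B → j ≤ pos u
    B-above {u} u∈ = ≮⇒≥ λ u<j → <⇒≱ (All.lookup (half-keys _ _ _ _ _ backward) u∈)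
      (≤-trans (∸-monoʳ-≤ (suc n) u<j) ≤-refl)

    unscanned : ∀ {p} → i ≤ p → p < j → ∃ λ z → pos z ≡ p × vtx p ≡ just z
    unscanned {p} i≤p p<j with full inv₀ (≤-trans i≥1 i≤p) (s≤s⁻¹ (≤-trans p<j j≤1+n))
    ... | z , eq with held inv₀ eq
    ...   | refl , _ = z , refl , placed-∉ removed (λ z∈ → Sum.[ (λ z∈F → <⇒≱ (F-below z∈F) i≤p)
                                                           , (λ z∈B → <⇒≱ p<j (B-above z∈B)) ]′ (∈-++⁻ F z∈))

  open Scanned

  skipF : ∀ {i j F B vtx c} → Scanned i j F B vtx c → ∀ z → pos z ≡ i → arcFrom G F z ≡ false →
          Scanned (suc i) j F B vtx (c + suc (length F))
  skipF {i} {F = F} s z refl arc = record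
    { forward  = subst (λ ps → Forward (suc i) ps F _) (sym (below-suc (i≥1 s))) (skip z refl arc (forward s))
    ; backward = backward s
    ; cost     = trans (cong (_+ suc (length F)) (cost s)) (arith (costF s) (costB s) (suc (length F)))
    ; removed  = removed s
    ; product  = ≤-trans (product s) (m≤m+n _ _)
    ; i≥1      = s≤s z≤n
    ; j≤1+n    = j≤1+n s
    }
    where
    arith : ∀ a b l → 1 + a + b + l ≡ 1 + (a + l) + b
    arith = solve-∀

  -- The alternation pays for the cycle test: the product grows by |B| = |F|, which is less than the
  -- cost 1 + |F| of the successful test. In `takeB` it grows by |F| = 1 + |B|, exactly the cost of
  -- that test.
  takeF : ∀ {i j F B vtx c} → Scanned i j F B vtx c → length F ≡ length B → ∀ z → pos z ≡ i → vtx i ≡ just z →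
          arcFrom G F z ≡ true → Scanned (suc i) j (F ++ [ z ]) B (setV vtx i nothing) (c + suc (length F))
  takeF {i} {F = F} {B} {c = c} s len z refl vi arc = record
    { forward  = subst (λ ps → Forward (suc i) ps (F ++ [ z ]) _) (sym (below-suc (i≥1 s))) (take z refl arc (forward s))
    ; backward = backward s
    ; cost     = trans (cong (_+ suc (length F)) (cost s)) (arith (costF s) (costB s) (suc (length F)))
    ; removed  = permute (subst (z ∷ F ++ B ↭_) (sym (List.++-assoc F [ z ] B)) (↭-sym (Perm.shift z F B)))
                   (erase vi (removed s))
    ; product  = begin
        length (F ++ [ z ]) * length B           ≡⟨ cong (_* length B) (length-∷ʳ F z) ⟩
        length B + length F * length B           ≤⟨ +-mono-≤ (≤-trans (≤-reflexive (sym len)) (n≤1+n _)) (product s) ⟩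
        suc (length F) + c                       ≡⟨ +-comm _ c ⟩
        c + suc (length F)                       ∎
    ; i≥1      = s≤s z≤n
    ; j≤1+n    = j≤1+n s
    }
    where
    open ≤-Reasoning
    arith : ∀ a b l → 1 + a + b + l ≡ 1 + (a + l) + b
    arith = solve-∀

  skipB : ∀ {i j F B vtx c} → Scanned i (suc j) F B vtx c → ∀ z → pos z ≡ j → arcTo G z B ≡ false →
          Scanned i j F B vtx (c + suc (length B))
  skipB {i} {j} {B = B} s z refl arc = record
    { forward  = forward s
    ; backward = subst₂ (λ k ps → Backward k ps B (costB s + suc (length B))) (sym (+-∸-assoc 1 (pos≤n inv₀ z))) (sym (from-step (pos≤n inv₀ z)))
                   (skip z refl arc (backward s))
    ; cost     = trans (cong (_+ suc (length B)) (cost s)) (arith (costF s) (costB s) (suc (length B)))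
    ; removed  = removed s
    ; product  = ≤-trans (product s) (m≤m+n _ _)
    ; i≥1      = i≥1 s
    ; j≤1+n    = ≤-trans (n≤1+n _) (j≤1+n s)
    }
    where
    arith : ∀ a b l → 1 + a + b + l ≡ 1 + a + (b + l)
    arith = solve-∀

  takeB : ∀ {i j F B vtx c} → Scanned i (suc j) F B vtx c → length F ≡ suc (length B) → ∀ z → pos z ≡ j →
          vtx j ≡ just z → arcTo G z B ≡ true → Scanned i j F (B ++ [ z ]) (setV vtx j nothing) (c + suc (length B))
  takeB {i} {j} {F} {B} {c = c} s len z refl vj arc = record
    { forward  = forward s
    ; backward = subst₂ (λ k ps → Backward k ps (B ++ [ z ]) (costB s + suc (length B))) (sym (+-∸-assoc 1 (pos≤n inv₀ z))) (sym (from-step (pos≤n inv₀ z)))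
                   (take z refl arc (backward s))
    ; cost     = trans (cong (_+ suc (length B)) (cost s)) (arith (costF s) (costB s) (suc (length B)))
    ; removed  = permute (subst (z ∷ F ++ B ↭_) (List.++-assoc F B [ z ]) (Perm.∷↭∷ʳ z (F ++ B)))
                   (erase vj (removed s))
    ; product  = begin
        length F * length (B ++ [ z ])           ≡⟨ cong (length F *_) (length-∷ʳ B z) ⟩
        length F * suc (length B)                ≡⟨ *-suc (length F) (length B) ⟩
        length F + length F * length B           ≤⟨ +-mono-≤ (≤-reflexive len) (product s) ⟩
        suc (length B) + c                       ≡⟨ +-comm _ c ⟩
        c + suc (length B)                       ∎
    ; i≥1      = i≥1 s
    ; j≤1+n    = ≤-trans (n≤1+n _) (j≤1+n s)
    }
    where
    open ≤-Reasoning
    arith : ∀ a b l → 1 + a + b + l ≡ 1 + a + (b + l)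
    arith = solve-∀

  -- After a forward stop slot t belongs to the backward side; after a backward stop
  -- it is the slot of the last vertex inserted into F.
  data Stopped (t : ℕ) (F B : List (Fin n)) (vtx : VArr n) (c : ℕ) : Set where
    inForward  : Scanned t t F B vtx c → length F ≡ length B → Stopped t F B vtx c
    inBackward : ∀ z → z ∈ F → pos z ≡ t → Scanned (suc t) (suc t) F B vtx c → length F ≡ suc (length B) →
                 Stopped t F B vtx c

  Finished : SearchState n → Set
  Finished (sst F B i j vtx c) = ∃ λ c′ → c ≡ suc c′ × i ≡ j × Stopped j F B vtx c′

  mutual
    -- Every recursive call, in either direction, reduces j - i by one and uses one unit of fuel,
    -- which preserves j < i + k. The slots between the scans still hold their vertices, so the null
    -- branches are never taken.
    fwdScan-stops : ∀ k {i j F B vtx c} → j < i + k → i ≤ j → length F ≡ length B →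
                    Scanned i j F B vtx c → Finished (fwdScan k G (sst F B i j vtx c))
    fwdScan-stops zero {i} j<i i≤j len s = contradiction (subst (_ <_) (+-identityʳ i) j<i) (≤⇒≯ i≤j)
    fwdScan-stops (suc k) {i} {j} {F} {B} {vtx} {c} j<i+k i≤j len s with i <ᵇ j in lt
    ... | false with ≤-antisym i≤j (≮⇒≥ (λ i<j → subst T lt (<⇒<ᵇ i<j)))
    ...   | refl = c , refl , refl , inForward s len
    fwdScan-stops (suc k) {i} {suc j} {F} {B} {vtx} {c} j<i+k i≤j len s | true
      with unscanned s ≤-refl (<ᵇ⇒< i (suc j) (subst T (sym lt) _))
    ... | z , pz , vi rewrite vi with arcFrom G F z in arc
    ...   | true  = bwdScan-stops k (s≤s⁻¹ (subst (suc j <_) (+-suc i k) j<i+k)) (s≤s⁻¹ (<ᵇ⇒< i (suc j) (subst T (sym lt) _)))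
                      (trans (length-∷ʳ F z) (cong suc len)) z (∈-++⁺ʳ F (here refl)) pz (takeF s len z pz vi arc)
    ...   | false = fwdScan-stops k (subst (suc j <_) (+-suc i k) j<i+k) (<ᵇ⇒< i (suc j) (subst T (sym lt) _)) len (skipF s z pz arc)

    bwdScan-stops : ∀ k {i j F B vtx c} → j < i + k → i ≤ j → length F ≡ suc (length B) → ∀ y → y ∈ F → pos y ≡ i →
                    Scanned (suc i) (suc j) F B vtx c → Finished (bwdScan k G (sst F B i j vtx c))
    bwdScan-stops zero {i} j<i i≤j len y y∈ py s = contradiction (subst (_ <_) (+-identityʳ i) j<i) (≤⇒≯ i≤j)
    bwdScan-stops (suc k) {i} {j} {F} {B} {vtx} {c} j<i+k i≤j len y y∈ py s with i <ᵇ j in lt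
    ... | false with ≤-antisym i≤j (≮⇒≥ (λ i<j → subst T lt (<⇒<ᵇ i<j)))
    ...   | refl = c , refl , refl , inBackward y y∈ py s len
    bwdScan-stops (suc k) {i} {suc j} {F} {B} {vtx} {c} j<i+k i≤j len y y∈ py s | true
      with unscanned s (<ᵇ⇒< i (suc j) (subst T (sym lt) _)) ≤-refl
    ... | z , pz , vj rewrite vj with arcTo G z B in arc
    ...   | true  = fwdScan-stops k (subst (suc j <_) (+-suc i k) j<i+k) (<ᵇ⇒< i (suc j) (subst T (sym lt) _))
                      (trans len (sym (length-∷ʳ B z))) (takeB s len z pz vj arc)
    ...   | false = bwdScan-stops k (s≤s⁻¹ (subst (suc j <_) (+-suc i k) j<i+k)) (s≤s⁻¹ (<ᵇ⇒< i (suc j) (subst T (sym lt) _)))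
                      len y y∈ py (skipB s z pz arc)

  search-stops : pos w < pos v → Finished (search G pos vtx₀ v w)
  search-stops w<v = fwdScan-stops (2 * n + 5) fuel w<v refl (record
    { forward  = subst (λ ps → Forward (suc (pos w)) ps [ w ] 0) (sym (below-suc (pos≥1 inv₀ w))) seed
    ; backward = subst₂ (λ k ps → Backward k ps [ v ] 0) (sym (+-∸-assoc 1 (pos≤n inv₀ v))) (sym (from-step (pos≤n inv₀ v))) seed
    ; cost     = refl
    ; removed  = permute (swap v w ↭-refl) (erase (trans (setV-≢ vtx₀ nothing (<⇒≢ w<v ∘ sym)) (placed-∉ inv₀ λ ()))
                                              (erase (placed-∉ inv₀ λ ()) inv₀))
    ; product  = ≤-refl
    ; i≥1      = s≤s z≤n
    ; j≤1+n    = m≤n⇒m≤1+n (pos≤n inv₀ v)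
    })
    where
    open ≤-Reasoning
    fuel : pos v < suc (pos w) + (2 * n + 5)
    fuel = begin-strict
      pos v                          ≤⟨ pos≤n inv₀ v ⟩
      n                              <⟨ m<m+n n (s≤s z≤n) ⟩
      n + suc (pos w + n + 5)        ≡⟨ arith n (pos w) ⟩
      suc (pos w) + (2 * n + 5)      ∎
      where
      arith : ∀ a b → a + suc (b + a + 5) ≡ suc b + (2 * a + 5)
      arith = solve-∀

-- State at the end of the search

Topological : ∀ {n} → Graph n → PArr n → Set
Topological G f = ∀ a b → G a b ≡ true → f a < f b

removed-null : ∀ {n} {vtx₀ vtx : VArr n} {pos W} → Numbering vtx₀ pos → Removed W vtx pos →
               ∀ {z} → z ∈ W → vtx (pos z) ≡ nothing
removed-null {vtx = vtx} {pos} inv₀ inv {z} z∈W with vtx (pos z) in eq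
... | nothing = refl
... | just y with held inv eq
...   | py≡pz , y∉W = contradiction (subst (_∈ _) (sym (pos-injective inv₀ y z py≡pz)) z∈W) y∉W

All-nulls : ∀ {n} {vtx : VArr n} {ps} → All (λ p → nullAt (vtx p) ≡ 0) ps → nulls vtx ps ≡ 0
All-nulls []       = refl
All-nulls (e ∷ es) = cong₂ _+_ e (All-nulls es)

sumₗ-cong : ∀ {A : Set} {f g : A → ℕ} {xs} → All (λ x → f x ≡ g x) xs → sumₗ (map f xs) ≡ sumₗ (map g xs)
sumₗ-cong []       = refl
sumₗ-cong (e ∷ es) = cong₂ _+_ e (sumₗ-cong es)

sumₗ-mono : ∀ {A : Set} {f g : A → ℕ} {xs} → All (λ x → f x ≤ g x) xs → sumₗ (map f xs) ≤ sumₗ (map g xs)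
sumₗ-mono []       = z≤n
sumₗ-mono (e ∷ es) = +-mono-≤ e (sumₗ-mono es)

sumₗ-suc : ∀ {A : Set} (f : A → ℕ) xs → sumₗ (map (suc ∘ f) xs) ≡ length xs + sumₗ (map f xs)
sumₗ-suc f []       = refl
sumₗ-suc f (x ∷ xs) = cong suc (trans (cong (f x +_) (sumₗ-suc f xs)) (arith (f x) (length xs) _))
  where
  arith : ∀ a b c → a + (b + c) ≡ b + (a + c)
  arith = solve-∀

length≤sumₗ : ∀ {A : Set} {f : A → ℕ} {xs} → All (λ x → 1 ≤ f x) xs → length xs ≤ sumₗ (map f xs)
length≤sumₗ []       = z≤n
length≤sumₗ (e ∷ es) = +-mono-≤ e (length≤sumₗ es)

module SearchResult {n} (G : Graph n) (pos : PArr n) (vtx₀ : VArr n) (inv₀ : Numbering vtx₀ pos) (v w : Fin n)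
                    (arcs : ∀ a b → G a b ≡ true → (a ≡ v × b ≡ w) ⊎ pos a < pos b) where

  open Search G pos vtx₀ inv₀ v w public
  open Scanned

  distF distB : ℕ → List (Fin n) → ℕ
  distF t F = sumₗ (map (λ u → t ∸ pos u) F)
  distB t B = sumₗ (map (λ u → suc (pos u) ∸ t) B)

  module _ {i j F B vtx c} (s : Scanned i j F B vtx c) (i≤j : i ≤ j) where

    present : ∀ {z} → z ∉ F → z ∉ B → nullAt (vtx (pos z)) ≡ 0
    present z∉F z∉B = cong nullAt (placed-∉ (removed s) (λ z∈ → Sum.[ z∉F , z∉B ]′ (∈-++⁻ F z∈)))

    at-slot : ∀ {p} → 1 ≤ p → p ≤ n → ∃ λ z → pos z ≡ p
    at-slot 1≤p p≤n with full inv₀ 1≤p p≤n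
    ... | z , eq = z , proj₁ (held inv₀ eq)

    -- Slots before `pos w` were never touched, and those of B lie at or above j ≥ i. Thus every
    -- null slot below i belongs to F and `half-nulls` applies.
    low : nulls vtx (below i) ≡ length F × nullWeight vtx (below i) ≡ distF i F
    low = half-nulls G pos pos w (below (pos w)) (All-nulls (All.zipWith full-slot
            (downward-≥1 (pred (pos w)) _ ≤-refl , downward-≤ (pred (pos w)) _)))
            (forward s) (All.tabulate (λ u∈F → removed-null inv₀ (removed s) (∈-++⁺ˡ u∈F)))
            (λ z z<i z∉F → present z∉F (λ z∈B → <⇒≱ z<i (≤-trans i≤j (B-above s z∈B))))
      where
      full-slot : ∀ {p} → 1 ≤ p × p ≤ pred (pos w) → nullAt (vtx p) ≡ 0
      full-slot {p} (1≤p , p≤) with at-slot 1≤p (≤-trans p≤ (≤-trans pred[n]≤n (pos≤n inv₀ w)))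
      ... | z , refl = present
        (λ z∈F → <⇒≱ z<w (All.lookup (proj₂ (half-≥seed _ _ _ _ _ (forward s))) z∈F))
        (λ z∈B → <⇒≱ (<-trans z<w (proj₁ (half-≥seed _ _ _ _ _ (forward s)))) (≤-trans i≤j (B-above s z∈B)))
        where
        z<w : pos z < pos w
        z<w = ≤-trans (s≤s p≤) (≤-reflexive (m+[n∸m]≡n (pos≥1 inv₀ w)))

    spread-reflect : spread fromTop (suc n ∸ j) B ≡ distB j B
    spread-reflect = sumₗ-cong {xs = B} (All.universal reflect B)
      where
      reflect : ∀ u → suc n ∸ j ∸ fromTop u ≡ suc (pos u) ∸ j
      reflect u = begin
        suc n ∸ j ∸ (n ∸ pos u)     ≡⟨ ∸-+-assoc (suc n) j _ ⟩
        suc n ∸ (j + (n ∸ pos u))   ≡⟨ cong (suc n ∸_) (+-comm j _) ⟩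
        suc n ∸ (n ∸ pos u + j)     ≡⟨ ∸-+-assoc (suc n) (n ∸ pos u) j ⟨
        suc n ∸ (n ∸ pos u) ∸ j     ≡⟨ cong (_∸ j) (+-∸-assoc 1 (m∸n≤m n (pos u))) ⟩
        suc (n ∸ (n ∸ pos u)) ∸ j   ≡⟨ cong (λ a → suc a ∸ j) (m∸[m∸n]≡n (pos≤n inv₀ u)) ⟩
        suc (pos u) ∸ j             ∎
        where open ≡-Reasoning

    high : nulls vtx (from j) ≡ length B × nullWeight vtx (from j) ≡ distB j B
    high with half-nulls (flip G) pos fromTop v (from (suc (pos v))) (All-nulls (All.zipWith full-slot
            (upward-≥ (suc (pos v)) _ , upward-< (suc (pos v)) _)))
            (backward s) (All.tabulate (λ u∈B → removed-null inv₀ (removed s) (∈-++⁺ʳ F u∈B)))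
            (λ z z< z∉B → present (λ z∈F → <⇒≱ (F-below s z∈F) (≤-trans i≤j (above z z<))) z∉B)
      where
      above : ∀ z → fromTop z < suc n ∸ j → j ≤ pos z
      above z z< = ≮⇒≥ λ z<j → <⇒≱ z< (∸-monoʳ-≤ (suc n) z<j)
      full-slot : ∀ {p} → suc (pos v) ≤ p × p < suc (pos v) + (n ∸ pos v) → nullAt (vtx p) ≡ 0
      full-slot {p} (v<p , p<) with at-slot (≤-trans (s≤s z≤n) v<p)
                                      (≤-trans (s≤s⁻¹ p<) (≤-reflexive (m+[n∸m]≡n (pos≤n inv₀ v))))
      ... | z , refl = present
        (λ z∈F → <⇒≱ (F-below s z∈F) (≤-trans i≤j (<⇒≤ (≤-<-trans (B-above s (half-∋ _ _ _ _ _ (backward s))) v<p))))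
        (λ z∈B → <⇒≱ (∸-monoʳ-< v<p (pos≤n inv₀ z)) (All.lookup (proj₂ (half-≥seed _ _ _ _ _ (backward s))) z∈B))
    ... | count , weight = count , trans weight spread-reflect

    costs : c ≤ 1 + (2 * distF i F + 2 * distB j B)
    costs = ≤-trans (≤-reflexive (trans (cost s) (+-assoc 1 (costF s) _)))
      (s≤s (+-mono-≤ (half-cost _ _ _ _ _ (forward s))
        (≤-trans (half-cost _ _ _ _ _ (backward s)) (≤-reflexive (cong (2 *_) spread-reflect)))))

module SearchSplit {n} (G : Graph n) (pos : PArr n) (vtx₀ : VArr n) (inv₀ : Numbering vtx₀ pos) (v w : Fin n)
                   (arcs : ∀ a b → G a b ≡ true → (a ≡ v × b ≡ w) ⊎ pos a < pos b) where

  open SearchResult G pos vtx₀ inv₀ v w arcs public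
  open Scanned

  -- What both ways of stopping have in common: F is to be placed from slot t upwards and B below t,
  -- and the null slots on each side match the length of the queue. Where the two cases give
  -- different bounds, the weaker one is recorded.
  record Split (t : ℕ) (F B : List (Fin n)) (vtx : VArr n) (c : ℕ) : Set where
    field
      removed    : Removed (F ++ B) vtx pos
      w∈F        : w ∈ F
      v∈B        : v ∈ B
      t≥1        : 1 ≤ t
      t≤n        : t ≤ n
      F≤t        : All (λ u → pos u ≤ t) F
      B≥t        : All (λ u → t ≤ pos u) B
      increasing : AllPairs (λ x y → pos x < pos y) F
      decreasing : AllPairs (λ x y → pos y < pos x) B
      reachedF   : All (λ u → ∀ f → Topological G f → f w ≤ f u) F
      reachedB   : All (λ u → ∀ f → Topological G f → f u ≤ f v) B
      completeF  : ∀ z → pos z < t → z ∈ F ⊎ All (λ u → G u z ≡ false) F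
      completeB  : ∀ z → t ≤ pos z → z ∉ F → z ∈ B ⊎ All (λ u → G z u ≡ false) B
      nulls-high : nulls vtx (from t) ≡ length F
      nulls-low  : nulls vtx (below t) ≡ length B
      weight-high : nullWeight vtx (from t) ≤ length F + distB t B
      weight-low  : nullWeight vtx (below t) ≤ distF (suc t) F
      searchCost : c ≤ 1 + (2 * distF (suc t) F + 2 * distB t B)
      pairs      : length F * length B ≤ c
      lengths    : length F ≤ suc (length B)

  fromTop-injective : ∀ x y → fromTop x ≡ fromTop y → x ≡ y
  fromTop-injective x y eq = pos-injective inv₀ x y (∸-cancelˡ-≡ (pos≤n inv₀ x) (pos≤n inv₀ y) eq)

  fromTop-< : ∀ {x y} → pos x < pos y → fromTop y < fromTop x
  fromTop-< {y = y} x<y = ∸-monoʳ-< x<y (pos≤n inv₀ y)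

  fromTop-<⁻ : ∀ {x y} → fromTop y < fromTop x → pos x < pos y
  fromTop-<⁻ {x} {y} lt = ≰⇒> λ y≤x → <⇒≱ lt (∸-monoʳ-≤ n y≤x)

  module _ {i j F B vtx c} (s : Scanned i j F B vtx c) where

    scanned-w∈F : w ∈ F
    scanned-w∈F = half-∋ _ _ _ _ _ (forward s)

    scanned-v∈B : v ∈ B
    scanned-v∈B = half-∋ _ _ _ _ _ (backward s)

    scanned-increasing : AllPairs (λ x y → pos x < pos y) F
    scanned-increasing = half-increasing _ _ _ _ _ (forward s)

    scanned-decreasing : AllPairs (λ x y → pos y < pos x) B
    scanned-decreasing = AllPairs.map fromTop-<⁻ (half-increasing _ _ _ _ _ (backward s))

    -- This is the form taken by "w reaches u": it is closed under arcs, it survives later additions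
    -- because they only reduce the set of admissible f, and it can be instantiated with any
    -- numbering.
    scanned-reachedF : All (λ u → ∀ f → Topological G f → f w ≤ f u) F
    scanned-reachedF = half-reached _ _ _ _ _ _
      (λ {u} {z} w≤u uz f topo → ≤-trans (w≤u f topo) (<⇒≤ (topo u z uz))) (λ _ _ → ≤-refl) (forward s)

    scanned-reachedB : All (λ u → ∀ f → Topological G f → f u ≤ f v) B
    scanned-reachedB = half-reached _ _ _ _ _ _
      (λ {u} {z} u≤v zu f topo → ≤-trans (<⇒≤ (topo z u zu)) (u≤v f topo)) (λ _ _ → ≤-refl) (backward s)

    scanned-completeF : ∀ z → pos z < i → z ∈ F ⊎ All (λ u → G u z ≡ false) F
    scanned-completeF = half-complete _ _ _ _ _ (pos-injective inv₀) (λ {u} {z} uz → Sum.map₁ proj₂ (arcs u z uz)) (forward s)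

    scanned-completeB : ∀ z → j ≤ pos z → z ∈ B ⊎ All (λ u → G z u ≡ false) B
    scanned-completeB z j≤z = half-complete _ _ _ _ _ fromTop-injective
      (λ {u} {y} yu → Sum.map proj₁ fromTop-< (arcs y u yu)) (backward s) z
      (≤-<-trans (∸-monoʳ-≤ n j≤z) (≤-reflexive (sym (+-∸-assoc 1 (≤-trans j≤z (pos≤n inv₀ z))))))

  distF-suc : ∀ t F → distF t F ≤ distF (suc t) F
  distF-suc t F = sumₗ-mono {xs = F} (All.universal (λ u → ∸-monoˡ-≤ (pos u) (n≤1+n t)) F)

  distB-suc : ∀ t B → distB (suc t) B ≤ distB t B
  distB-suc t B = sumₗ-mono {xs = B} (All.universal (λ u → ∸-monoʳ-≤ (suc (pos u)) (n≤1+n t)) B)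

  -- After a backward stop slot t is null too, being the former slot of y in F. Counted on the upper
  -- side, it gives 1 + |B| = |F| null slots there and leaves |F| - 1 = |B| below.
  stopped-split : ∀ {t F B vtx c} → Stopped t F B vtx c → Split t F B vtx c
  stopped-split {t} {F} {B} (inForward s len) = record
    { removed    = removed s
    ; w∈F        = scanned-w∈F s
    ; v∈B        = scanned-v∈B s
    ; t≥1        = i≥1 s
    ; t≤n        = ≤-trans (B-above s (scanned-v∈B s)) (pos≤n inv₀ v)
    ; F≤t        = All.tabulate (<⇒≤ ∘ F-below s)
    ; B≥t        = All.tabulate (B-above s)
    ; increasing = scanned-increasing s
    ; decreasing = scanned-decreasing s
    ; reachedF   = scanned-reachedF s
    ; reachedB   = scanned-reachedB s
    ; completeF  = scanned-completeF s
    ; completeB  = λ z t≤z _ → scanned-completeB s z t≤z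
    ; nulls-high = trans (proj₁ (high s ≤-refl)) (sym len)
    ; nulls-low  = trans (proj₁ (low s ≤-refl)) len
    ; weight-high = ≤-trans (≤-reflexive (proj₂ (high s ≤-refl))) (m≤n+m _ (length F))
    ; weight-low  = ≤-trans (≤-reflexive (proj₂ (low s ≤-refl))) (distF-suc t F)
    ; searchCost = ≤-trans (costs s ≤-refl) (+-monoʳ-≤ 1 (+-monoˡ-≤ _ (*-monoʳ-≤ 2 (distF-suc t F))))
    ; pairs      = product s
    ; lengths    = ≤-trans (≤-reflexive len) (n≤1+n _)
    }
  stopped-split {t} {F} {B} {vtx} (inBackward y y∈F refl s len) = record
    { removed    = removed s
    ; w∈F        = scanned-w∈F s
    ; v∈B        = scanned-v∈B s
    ; t≥1        = pos≥1 inv₀ y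
    ; t≤n        = pos≤n inv₀ y
    ; F≤t        = All.tabulate (s≤s⁻¹ ∘ F-below s)
    ; B≥t        = All.tabulate (<⇒≤ ∘ B-above s)
    ; increasing = scanned-increasing s
    ; decreasing = scanned-decreasing s
    ; reachedF   = scanned-reachedF s
    ; reachedB   = scanned-reachedB s
    ; completeF  = λ z z<t → scanned-completeF s z (m<n⇒m<1+n z<t)
    ; completeB  = λ z t≤z z∉F → scanned-completeB s z (≤∧≢⇒< t≤z
                     (λ y≡z → z∉F (subst (_∈ F) (pos-injective inv₀ y z y≡z) y∈F)))
    ; nulls-high = nulls-high′
    ; nulls-low  = suc-injective (trans (sym nulls-low′) (trans (proj₁ (low s ≤-refl)) len))
    ; weight-high = subst (λ ps → nullWeight vtx ps ≤ length F + distB t B) (sym (from-step (pos≤n inv₀ y)))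
        (+-mono-≤ (≤-reflexive (trans (cong (nulls vtx) (sym (from-step (pos≤n inv₀ y)))) nulls-high′))
                  (≤-trans (≤-reflexive (proj₂ (high s ≤-refl))) (distB-suc t B)))
    ; weight-low  = ≤-trans (m≤n+m _ (nulls vtx (t ∷ below t)))
        (≤-reflexive (trans (cong (nullWeight vtx) (sym (below-suc (pos≥1 inv₀ y)))) (proj₂ (low s ≤-refl))))
    ; searchCost = ≤-trans (costs s ≤-refl) (+-monoʳ-≤ 1 (+-monoʳ-≤ (2 * distF (suc t) F) (*-monoʳ-≤ 2 (distB-suc t B))))
    ; pairs      = product s
    ; lengths    = ≤-reflexive len
    }
    where
    t-null : nullAt (vtx t) ≡ 1
    t-null = cong nullAt (removed-null inv₀ (removed s) (∈-++⁺ˡ y∈F))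
    nulls-high′ : nulls vtx (from t) ≡ length F
    nulls-high′ = trans (cong (nulls vtx) (from-step (pos≤n inv₀ y)))
      (trans (cong₂ _+_ t-null (proj₁ (high s ≤-refl))) (sym len))
    nulls-low′ : nulls vtx (below (suc t)) ≡ 1 + nulls vtx (below t)
    nulls-low′ = trans (cong (nulls vtx) (below-suc (pos≥1 inv₀ y))) (cong (_+ nulls vtx (below t)) t-null)

-- Correctness of the reordering

AllPairs-right : ∀ {A : Set} {P : A → Set} {xs} → All P xs → AllPairs (λ _ y → P y) xs
AllPairs-right []       = []
AllPairs-right (p ∷ ps) = ps ∷ AllPairs-right ps

Unique-++⁻ : ∀ {A : Set} (xs : List A) {ys x} → Unique (xs ++ ys) → x ∈ xs → x ∉ ys
Unique-++⁻ (x ∷ xs) (x∉ ∷ _) (here refl) x∈ys = All.lookup x∉ (∈-++⁺ʳ xs x∈ys) refl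
Unique-++⁻ (_ ∷ xs) (_ ∷ u)  (there x∈)  x∈ys = Unique-++⁻ xs u x∈ x∈ys

module Reordering {n} (G : Graph n) (pos : PArr n) (vtx₀ : VArr n) (inv₀ : Numbering vtx₀ pos) (v w : Fin n)
                  (arcs : ∀ a b → G a b ≡ true → (a ≡ v × b ≡ w) ⊎ pos a < pos b) where

  open SearchSplit G pos vtx₀ inv₀ v w arcs public
  open Split

  module _ {t F B vtx c} (s : Split t F B vtx c) where

    from-slots : All (λ p → t ≤ p × p ≤ n) (from t)
    from-slots = All.zipWith (λ {p} (t≤p , p<) → t≤p , s≤s⁻¹ (≤-trans p< (≤-reflexive (m+[n∸m]≡n (m≤n⇒m≤1+n (t≤n s))))))
                   (upward-≥ t _ , upward-< t _)

    below-slots : All (λ p → 1 ≤ p × p < t) (below t)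
    below-slots = All.zipWith (λ {p} (1≤p , p≤) → 1≤p , ≤-trans (s≤s p≤) (≤-reflexive (m+[n∸m]≡n (t≥1 s))))
                    (downward-≥1 (pred t) _ ≤-refl , downward-≤ (pred t) _)

    ∈-from : ∀ {p} → t ≤ p → p ≤ n → p ∈ from t
    ∈-from t≤p p≤n = upward-∈ t _ t≤p (≤-trans (s≤s p≤n) (≤-reflexive (sym (m+[n∸m]≡n (m≤n⇒m≤1+n (t≤n s))))))

    ∈-below : ∀ {p} → 1 ≤ p → p < t → p ∈ below t
    ∈-below {p} 1≤p p<t = downward-∈ (pred t) 1≤p (s≤s⁻¹ (≤-trans p<t (≤-reflexive (sym (m+[n∸m]≡n (t≥1 s))))))

    from-unique : Unique (from t)
    from-unique = AllPairs.map <⇒≢ (upward-increasing t (suc n ∸ t))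

    below-unique : Unique (below t)
    below-unique = AllPairs.map >⇒≢ (downward-decreasing (pred t) (pred t) ≤-refl)

    below-∉-from : All (_∉ from t) (below t)
    below-∉-from = All.map (λ (_ , p<t) p∈ → <⇒≱ p<t (proj₁ (All.lookup from-slots p∈))) below-slots

    from-∉-below : All (_∉ below t) (from t)
    from-∉-below = All.map (λ (t≤p , _) p∈ → <⇒≱ (proj₂ (All.lookup below-slots p∈)) t≤p) from-slots

    F∉B : ∀ {x} → x ∈ F → x ∉ B
    F∉B = Unique-++⁻ F (unique (removed s))

    kept : ∀ {p x} → vtx p ≡ just x → pos x ≡ p × x ∉ F × x ∉ B
    kept eq with held (removed s) eq
    ... | px≡p , x∉ = px≡p , x∉ ∘ ∈-++⁺ˡ , x∉ ∘ ∈-++⁺ʳ F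

    -- The list follows the old positions. An arc against them could only be the new one, which
    -- starts in v; but v is in B and hence not in the list.
    high-ordered : AllPairs (NoBackArc G) (F ++ mapMaybe vtx (from t))
    high-ordered = AllPairs.map no-arc (AllPairs.++⁺
      (AllPairs.zip (increasing s , AllPairs-right (All.tabulate λ x∈F → λ { refl → F∉B x∈F (v∈B s) })))
      (AllPairs-contents⁺ vtx (AllPairs.map slots (upward-increasing t (suc n ∸ t))))
      (All.tabulate λ x∈F → All.tabulate λ y∈ → cross x∈F (∈-contents vtx y∈)))
      where
      Before : Fin n → Fin n → Set
      Before x y = pos x < pos y × y ≢ v
      no-arc : ∀ {x y} → Before x y → G y x ≡ false
      no-arc {x} {y} (x<y , y≢v) with G y x in yx
      ... | false = refl
      ... | true with arcs y x yx
      ...   | inj₁ (y≡v , _) = contradiction y≡v y≢v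
      ...   | inj₂ y<x = contradiction y<x (<-asym x<y)
      slots : ∀ {p q} → p < q → ∀ x y → vtx p ≡ just x → vtx q ≡ just y → Before x y
      slots p<q x y vp vq with kept vp | kept vq
      ... | refl , _ | refl , _ , y∉B = p<q , λ { refl → y∉B (v∈B s) }
      cross : ∀ {x y} → x ∈ F → (∃ λ p → p ∈ from t × vtx p ≡ just y) → Before x y
      cross {x} {y} x∈F (p , p∈ , vp) with kept vp
      ... | refl , y∉F , y∉B = ≤∧≢⇒< (≤-trans (All.lookup (F≤t s) x∈F) (proj₁ (All.lookup from-slots p∈)))
                                 (λ x≡y → y∉F (subst (_∈ F) (pos-injective inv₀ x y x≡y) x∈F)) ,
                               λ { refl → y∉B (v∈B s) }

    low-ordered : AllPairs (NoBackArc (flip G)) (B ++ mapMaybe vtx (below t))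
    low-ordered = AllPairs.map no-arc (AllPairs.++⁺
      (AllPairs.zip (decreasing s , AllPairs-right (All.tabulate λ x∈B → λ { refl → F∉B (w∈F s) x∈B })))
      (AllPairs-contents⁺ vtx (AllPairs.map slots (downward-decreasing (pred t) (pred t) ≤-refl)))
      (All.tabulate λ x∈B → All.tabulate λ y∈ → cross x∈B (∈-contents vtx y∈)))
      where
      After : Fin n → Fin n → Set
      After x y = pos y < pos x × y ≢ w
      no-arc : ∀ {x y} → After x y → G x y ≡ false
      no-arc {x} {y} (y<x , y≢w) with G x y in xy
      ... | false = refl
      ... | true with arcs x y xy
      ...   | inj₁ (_ , y≡w) = contradiction y≡w y≢w
      ...   | inj₂ x<y = contradiction x<y (<-asym y<x)
      slots : ∀ {p q} → p > q → ∀ x y → vtx p ≡ just x → vtx q ≡ just y → After x y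
      slots p>q x y vp vq with kept vp | kept vq
      ... | refl , _ | refl , y∉F , _ = p>q , λ { refl → y∉F (w∈F s) }
      cross : ∀ {x y} → x ∈ B → (∃ λ p → p ∈ below t × vtx p ≡ just y) → After x y
      cross {x} {y} x∈B (p , p∈ , vp) with kept vp
      ... | refl , y∉F , y∉B = <-≤-trans (proj₂ (All.lookup below-slots p∈)) (All.lookup (B≥t s) x∈B) ,
                               λ { refl → y∉F (w∈F s) }

    module _ (acyclic : ∀ {u z} → u ∈ F → z ∈ B → G u z ≡ false)
             {vtx₁ vtx₂ : VArr n} {pos₁ pos₂ : PArr n} {costF costB : ℕ}
             (passF : Pass G (from t) F vtx pos vtx₁ pos₁ costF)
             (passB : Pass (flip G) (below t) B vtx₁ pos₁ vtx₂ pos₂ costB) where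

      below-agree : Agree vtx₁ vtx (below t)
      below-agree = All.map (pass-outside G passF) below-∉-from

      from-agree : Agree vtx₂ vtx₁ (from t)
      from-agree = All.map (pass-outside (flip G) passB) from-∉-below

      numbering₂ : Numbering vtx₂ pos₂
      numbering₂ = pass-removed (flip G) passB
        (All.map (λ (1≤p , p<t) → 1≤p , ≤-trans (<⇒≤ p<t) (t≤n s)) below-slots)
        (subst (λ W → Removed W vtx₁ pos₁) (sym (List.++-identityʳ B))
          (pass-removed G passF (All.map (λ (t≤p , p≤n) → ≤-trans (t≥1 s) t≤p , p≤n) from-slots) (removed s)))

      -- What can end up in the slots from t upwards, or below t, described by the situation at the
      -- end of the search.
      Upper Lower : Fin n → Set
      Upper x = x ∈ F ⊎ (t ≤ pos x × x ∉ F × x ∉ B)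
      Lower x = x ∈ B ⊎ (pos x < t × x ∉ F × x ∉ B)

      upper : ∀ {p x} → p ∈ from t → vtx₂ p ≡ just x → Upper x
      upper {p} {x} p∈ eq with ∈-++⁻ F (Perm.∈-resp-↭ (pass-contents G passF from-unique)
                            (contents-∈ vtx₁ p∈ (trans (sym (All.lookup from-agree p∈)) eq)))
      ... | inj₁ x∈F = inj₁ x∈F
      ... | inj₂ x∈ with ∈-contents vtx x∈
      ...   | q , q∈ , vq with kept vq
      ...     | refl , x∉F , x∉B = inj₂ (proj₁ (All.lookup from-slots q∈) , x∉F , x∉B)

      lower : ∀ {p x} → p ∈ below t → vtx₂ p ≡ just x → Lower x
      lower {p} {x} p∈ eq with ∈-++⁻ B (Perm.∈-resp-↭ (pass-contents (flip G) passB below-unique) (contents-∈ vtx₂ p∈ eq))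
      ... | inj₁ x∈B = inj₁ x∈B
      ... | inj₂ x∈ with ∈-contents vtx₁ x∈
      ...   | q , q∈ , vq with kept (trans (sym (All.lookup below-agree q∈)) vq)
      ...     | refl , x∉F , x∉B = inj₂ (proj₂ (All.lookup below-slots q∈) , x∉F , x∉B)

      at : ∀ x → vtx₂ (pos₂ x) ≡ just x
      at x = placed-∉ numbering₂ λ ()

      side : ∀ x → pos₂ x ∈ from t ⊎ pos₂ x ∈ below t
      side x with t ≤? pos₂ x
      ... | yes t≤ = inj₁ (∈-from t≤ (pos≤n numbering₂ x))
      ... | no  t≰ = inj₂ (∈-below (pos≥1 numbering₂ x) (≰⇒> t≰))

      -- The four cases have four reasons: the cycle test for F to B, completeness of the forward
      -- scan for arcs leaving F, completeness of the backward scan for arcs entering B, and the old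
      -- numbering for vertices outside both queues.
      upper-lower : ∀ {a b} → Upper a → Lower b → G a b ≡ false
      upper-lower (inj₁ a∈F) (inj₁ b∈B) = acyclic a∈F b∈B
      upper-lower {b = b} (inj₁ a∈F) (inj₂ (b<t , b∉F , _)) with completeF s b b<t
      ... | inj₁ b∈F  = contradiction b∈F b∉F
      ... | inj₂ none = All.lookup none a∈F
      upper-lower {a} (inj₂ (t≤a , a∉F , a∉B)) (inj₁ b∈B) with completeB s a t≤a a∉F
      ... | inj₁ a∈B  = contradiction a∈B a∉B
      ... | inj₂ none = All.lookup none b∈B
      upper-lower {a} {b} (inj₂ (t≤a , _ , a∉B)) (inj₂ (b<t , _)) with G a b in ab
      ... | false = refl
      ... | true with arcs a b ab
      ...   | inj₁ (refl , _) = contradiction (v∈B s) a∉B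
      ...   | inj₂ a<b = contradiction (<-trans (≤-<-trans t≤a a<b) b<t) (<-irrefl refl)

      loopless : ∀ a → G a a ≢ true
      loopless a aa with arcs a a aa
      ... | inj₁ (refl , refl) = F∉B (w∈F s) (v∈B s)
      ... | inj₂ a<a = <-irrefl refl a<a

      topological₂ : Topological G pos₂
      topological₂ a b ab with side a | side b
      ... | inj₁ a∈ | inj₂ b∈ = contradiction (trans (sym ab) (upper-lower (upper a∈ (at a)) (lower b∈ (at b)))) λ ()
      ... | inj₂ a∈ | inj₁ b∈ = <-≤-trans (proj₂ (All.lookup below-slots a∈)) (proj₁ (All.lookup from-slots b∈))
      ... | inj₁ a∈ | inj₁ b∈ with AllPairs-∈ (AllPairs.zip (upward-increasing t (suc n ∸ t) ,
                                     AllPairs-contents⁻ vtx₁ (pass-order G passF from-unique high-ordered))) a∈ b∈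
      ...   | inj₁ a≡b = contradiction (subst (λ z → G a z ≡ true) (sym (pos-injective numbering₂ a b a≡b)) ab) (loopless a)
      ...   | inj₂ (inj₁ (a<b , _)) = a<b
      ...   | inj₂ (inj₂ (_ , none)) = contradiction
                (trans (sym ab) (none b a (trans (sym (All.lookup from-agree b∈)) (at b)) (trans (sym (All.lookup from-agree a∈)) (at a)))) λ ()
      topological₂ a b ab | inj₂ a∈ | inj₂ b∈ with AllPairs-∈ (AllPairs.zip (downward-decreasing (pred t) (pred t) ≤-refl ,
                                     AllPairs-contents⁻ vtx₂ (pass-order (flip G) passB below-unique
                                       (subst (λ cs → AllPairs (NoBackArc (flip G)) (B ++ cs)) (sym (contents-cong below-agree)) low-ordered)))) a∈ b∈
      ...   | inj₁ a≡b = contradiction (subst (λ z → G a z ≡ true) (sym (pos-injective numbering₂ a b a≡b)) ab) (loopless a)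
      ...   | inj₂ (inj₁ (_ , none)) = contradiction (trans (sym ab) (none a b (at a) (at b))) λ ()
      ...   | inj₂ (inj₂ (a<b , _)) = a<b

      movesF : ∀ {x} → pos₂ x ∈ from t → pos x ≡ pos₂ x ⊎ ((∀ f → Topological G f → f w ≤ f x) × pos x ≤ pos₂ x)
      movesF {x} x∈ = All.lookup (pass-moves G (λ x → ∀ f → Topological G f → f w ≤ f x)
          (λ {u} {z} w≤u uz f topo → ≤-trans (w≤u f topo) (<⇒≤ (topo u z uz))) _≤_ (λ _ → ≤-refl) pos passF from-unique
          (AllPairs.map <⇒≤ (upward-increasing t (suc n ∸ t))) (All.universal (λ _ _ → proj₁ ∘ kept) _)
          (All.zipWith (λ (r , x≤t) → r , All.map (≤-trans x≤t ∘ proj₁) from-slots) (reachedF s , F≤t s)))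
        x∈ x (trans (sym (All.lookup from-agree x∈)) (at x))

      movesB : ∀ {x} → pos₂ x ∈ below t → pos x ≡ pos₂ x ⊎ ((∀ f → Topological G f → f x ≤ f v) × pos x ≥ pos₂ x)
      movesB {x} x∈ = All.lookup (pass-moves (flip G) (λ x → ∀ f → Topological G f → f x ≤ f v)
          (λ {u} {z} u≤v zu f topo → ≤-trans (<⇒≤ (topo z u zu)) (u≤v f topo)) _≥_ (λ _ → ≤-refl) pos passB below-unique
          (AllPairs.map <⇒≤ (downward-decreasing (pred t) (pred t) ≤-refl))
          (All.map (λ e _ e′ → proj₁ (kept (trans (sym e) e′))) below-agree)
          (All.zipWith (λ (r , t≤x) → r , All.map (λ (_ , p<t) → ≤-trans (<⇒≤ p<t) t≤x) below-slots) (reachedB s , B≥t s)))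
        x∈ x (at x)

      -- Vertices placed from t upwards never fall and those placed below t never rise. A rising
      -- vertex has thus passed through the forward queue, which only admits vertices reached from
      -- w.
      rises : ∀ x → pos x < pos₂ x → ∀ f → Topological G f → f w ≤ f x
      rises x x<x₂ with side x
      ... | inj₁ x∈ with movesF x∈
      ...   | inj₁ eq = contradiction eq (<⇒≢ x<x₂)
      ...   | inj₂ (r , _) = r
      rises x x<x₂ | inj₂ x∈ with movesB x∈
      ...   | inj₁ eq = contradiction eq (<⇒≢ x<x₂)
      ...   | inj₂ (_ , x₂≤x) = contradiction x₂≤x (<⇒≱ x<x₂)

      falls : ∀ x → pos₂ x < pos x → ∀ f → Topological G f → f x ≤ f v
      falls x x₂<x with side x
      ... | inj₂ x∈ with movesB x∈
      ...   | inj₁ eq = contradiction eq (>⇒≢ x₂<x)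
      ...   | inj₂ (r , _) = r
      falls x x₂<x | inj₁ x∈ with movesF x∈
      ...   | inj₁ eq = contradiction eq (>⇒≢ x₂<x)
      ...   | inj₂ (_ , x≤x₂) = contradiction x≤x₂ (<⇒≱ x₂<x)

      F-high : All (λ x → t ≤ pos₂ x) F
      F-high = All.tabulate λ x∈F → high-slot (∈-contents vtx₁
                 (Perm.∈-resp-↭ (↭-sym (pass-contents G passF from-unique)) (∈-++⁺ˡ x∈F)))
        where
        high-slot : ∀ {x} → (∃ λ p → p ∈ from t × vtx₁ p ≡ just x) → t ≤ pos₂ x
        high-slot (p , p∈ , eq) with held numbering₂ (trans (All.lookup from-agree p∈) eq)
        ... | refl , _ = proj₁ (All.lookup from-slots p∈)

      B-low : All (λ x → pos₂ x < t) B
      B-low = All.tabulate λ x∈B → low-slot (∈-contents vtx₂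
                 (Perm.∈-resp-↭ (↭-sym (pass-contents (flip G) passB below-unique)) (∈-++⁺ˡ x∈B)))
        where
        low-slot : ∀ {x} → (∃ λ p → p ∈ below t × vtx₂ p ≡ just x) → pos₂ x < t
        low-slot (p , p∈ , eq) with held numbering₂ eq
        ... | refl , _ = proj₂ (All.lookup below-slots p∈)

-- Charging an addition to its movement

module ReorderingCost {n} (G : Graph n) (pos : PArr n) (vtx₀ : VArr n) (inv₀ : Numbering vtx₀ pos) (v w : Fin n)
                      (arcs : ∀ a b → G a b ≡ true → (a ≡ v × b ≡ w) ⊎ pos a < pos b) where

  open Reordering G pos vtx₀ inv₀ v w arcs public
  open Split

  module _ {t F B vtx c} (s : Split t F B vtx c) where

    F-unique : Unique F
    F-unique = AllPairs.map (λ x<y → <⇒≢ x<y ∘ cong pos) (increasing s)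

    B-unique : Unique B
    B-unique = AllPairs.map (λ y<x → >⇒≢ y<x ∘ cong pos) (decreasing s)

    -- No movement is available to pay, so the distances are estimated crudely: each of the two sums
    -- has at most n terms of size at most n. The total 5 + 8 n² is at most 13 n² as n ≥ 1.
    cycle-cost : 1 + suc c + suc (length F * length B) ≤ 13 * (n * n)
    cycle-cost = begin
      1 + suc c + suc (length F * length B)         ≤⟨ +-monoʳ-≤ (1 + suc c) (s≤s (pairs s)) ⟩
      1 + suc c + suc c                             ≤⟨ +-mono-≤ (s≤s (s≤s c≤)) (s≤s c≤) ⟩
      1 + suc (1 + (2 * N + 2 * N)) + suc (1 + (2 * N + 2 * N)) ≡⟨ arith₁ N ⟩
      5 + 8 * N                                     ≤⟨ +-monoˡ-≤ (8 * N) (*-monoʳ-≤ 5 (*-mono-≤ n≥1 n≥1)) ⟩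
      5 * N + 8 * N                                 ≡⟨ arith₂ N ⟩
      13 * (n * n)                                  ∎
      where
      open ≤-Reasoning
      N = n * n
      n≥1 : 1 ≤ n
      n≥1 = ≤-trans (t≥1 s) (t≤n s)
      arith₁ : ∀ a → 1 + suc (1 + (2 * a + 2 * a)) + suc (1 + (2 * a + 2 * a)) ≡ 5 + 8 * a
      arith₁ = solve-∀
      arith₂ : ∀ a → 5 * a + 8 * a ≡ 13 * a
      arith₂ = solve-∀
      c≤ : c ≤ 1 + (2 * N + 2 * N)
      c≤ = ≤-trans (searchCost s) (+-monoʳ-≤ 1 (+-mono-≤
        (*-monoʳ-≤ 2 (≤-trans (unique-sum≤sum _ F-unique) (sum-≤-const n (λ u → ≤-trans (∸-monoʳ-≤ (suc t) (pos≥1 inv₀ u)) (t≤n s)))))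
        (*-monoʳ-≤ 2 (≤-trans (unique-sum≤sum _ B-unique) (sum-≤-const n (λ u → ≤-trans (∸-monoʳ-≤ (suc (pos u)) (t≥1 s)) (pos≤n inv₀ u)))))))

    module _ (acyclic : ∀ {u z} → u ∈ F → z ∈ B → G u z ≡ false)
             {vtx₁ vtx₂ : VArr n} {pos₁ pos₂ : PArr n} {costF costB : ℕ}
             (passF : Pass G (from t) F vtx pos vtx₁ pos₁ costF)
             (passB : Pass (flip G) (below t) B vtx₁ pos₁ vtx₂ pos₂ costB) where

      movement : ℕ
      movement = sum (λ x → pos₂ x ∸ pos x)

      -- A vertex of F ends at t or above, so it rises by at least t - `pos u`; measuring from t + 1
      -- costs one more unit per vertex.
      distF≤ : distF (suc t) F ≤ length F + movement
      distF≤ = begin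
        distF (suc t) F                                     ≤⟨ sumₗ-mono (All.map (λ {u} t≤ → rise u t≤) (F-high s acyclic passF passB)) ⟩
        sumₗ (map (λ u → suc (pos₂ u ∸ pos u)) F)           ≡⟨ sumₗ-suc (λ u → pos₂ u ∸ pos u) F ⟩
        length F + sumₗ (map (λ u → pos₂ u ∸ pos u) F)      ≤⟨ +-monoʳ-≤ (length F) (unique-sum≤sum _ F-unique) ⟩
        length F + movement                                 ∎
        where
        open ≤-Reasoning
        rise : ∀ u → t ≤ pos₂ u → suc t ∸ pos u ≤ suc (pos₂ u ∸ pos u)
        rise u t≤ = m≤n+o⇒m∸n≤o (suc t) (pos u) (≤-trans (s≤s (≤-trans t≤ (m≤n+m∸n (pos₂ u) (pos u))))
                      (≤-reflexive (sym (+-suc (pos u) _))))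

      same-count : ∀ p → sum (λ x → ind (pos x ≤? p)) ≡ sum (λ x → ind (pos₂ x ≤? p))
      same-count p = trans (sum-positions inv₀ (λ q → ind (q ≤? p)))
                           (sym (sum-positions (numbering₂ s acyclic passF passB) (λ q → ind (q ≤? p))))

      -- A vertex of B ends strictly below t, so its distance to t - 1 is at most its fall; the
      -- total fall equals the total rise.
      distB≤ : distB t B ≤ movement
      distB≤ = begin
        distB t B                                  ≤⟨ sumₗ-mono (All.map (λ {u} <t → ∸-monoʳ-≤ (suc (pos u)) <t) (B-low s acyclic passF passB)) ⟩
        sumₗ (map (λ u → pos u ∸ pos₂ u) B)        ≤⟨ unique-sum≤sum _ B-unique ⟩
        sum (λ u → pos u ∸ pos₂ u)                 ≡⟨ Balance.ups≡downs pos pos₂ same-count (pos≤n inv₀) (pos≤n (numbering₂ s acyclic passF passB)) ⟨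
        movement                                   ∎
        where open ≤-Reasoning

      -- Every vertex of B falls by at least one slot, and F has at most one vertex more than B.
      -- This absorbs the terms in |F| that come from slot t.
      lengthF≤ : length F ≤ 1 + movement
      lengthF≤ = ≤-trans (lengths s) (s≤s (≤-trans (length≤sumₗ (All.map (λ t≤ → m<n⇒0<n∸m (s≤s t≤)) (B≥t s))) distB≤))

      -- Search and cycle test each cost about 2 (f + b), since |F| |B| ≤ c. The forward pass fills
      -- slots of B and costs about 3 (l + b), the backward pass fills slots of F and costs about 3
      -- f.
      total-cost : 1 + suc c + suc (length F * length B) + costF + costB ≤ 24 * suc movement
      total-cost = begin
        1 + suc c + suc (length F * length B) + costF + costB
          ≤⟨ +-mono-≤ (+-mono-≤ (+-monoʳ-≤ (1 + suc c) (s≤s (pairs s))) costF≤) costB≤ ⟩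
        1 + suc c + suc c + (1 + 3 * (l + b)) + (1 + 3 * f)
          ≤⟨ +-monoˡ-≤ _ (+-monoˡ-≤ _ (+-mono-≤ (s≤s (s≤s (searchCost s))) (s≤s (searchCost s)))) ⟩
        1 + suc (1 + (2 * f + 2 * b)) + suc (1 + (2 * f + 2 * b)) + (1 + 3 * (l + b)) + (1 + 3 * f)
          ≡⟨ arith₁ f b l ⟩
        7 + 7 * f + (7 * b + 3 * l)
          ≤⟨ +-mono-≤ (+-monoʳ-≤ 7 (*-monoʳ-≤ 7 (≤-trans distF≤ (+-monoˡ-≤ movement lengthF≤))))
                      (+-mono-≤ (*-monoʳ-≤ 7 distB≤) (*-monoʳ-≤ 3 lengthF≤)) ⟩
        7 + 7 * (1 + movement + movement) + (7 * movement + 3 * (1 + movement))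
          -- The estimate is 17 + 24 T at this point; 7 more units round it to 24 (1 + T).
          ≤⟨ m≤n+m _ 7 ⟩
        7 + (7 + 7 * (1 + movement + movement) + (7 * movement + 3 * (1 + movement)))
          ≡⟨ arith₂ movement ⟩
        24 * suc movement ∎
        where
        open ≤-Reasoning
        f = distF (suc t) F
        b = distB t B
        l = length F
        costF≤ : costF ≤ 1 + 3 * (l + b)
        costF≤ = ≤-trans (pass-cost G passF (from-unique s) (nulls-high s)) (s≤s (*-monoʳ-≤ 3 (weight-high s)))
        costB≤ : costB ≤ 1 + 3 * f
        costB≤ = ≤-trans (pass-cost (flip G) passB (below-unique s)
                   (trans (nulls-cong (below-agree s acyclic passF passB)) (nulls-low s)))
          (s≤s (*-monoʳ-≤ 3 (≤-trans (≤-reflexive (nullWeight-cong (below-agree s acyclic passF passB))) (weight-low s))))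
        arith₁ : ∀ f b l → 1 + suc (1 + (2 * f + 2 * b)) + suc (1 + (2 * f + 2 * b)) + (1 + 3 * (l + b)) + (1 + 3 * f)
                         ≡ 7 + 7 * f + (7 * b + 3 * l)
        arith₁ = solve-∀
        arith₂ : ∀ m → 7 + (7 + 7 * (1 + m + m) + (7 * m + 3 * (1 + m))) ≡ 24 * suc m
        arith₂ = solve-∀

-- A single arc addition

record Valid {n} (s : AlgState n) : Set where
  constructor valid
  field
    numbering   : Numbering (AlgState.vtx s) (AlgState.pos s)
    topological : Topological (AlgState.graph s) (AlgState.pos s)

module _ {n} (G : Graph n) (v w : Fin n) where

  addArc-new : addArc G v w v w ≡ true
  addArc-new rewrite dec-true (v Fin.≟ v) refl | dec-true (w Fin.≟ w) refl = refl

  addArc-old : ∀ {a b} → G a b ≡ true → addArc G v w a b ≡ true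
  addArc-old {a} {b} ab rewrite ab = ∨-zeroʳ (does (a Fin.≟ v) ∧ does (b Fin.≟ w))

  addArc⁻ : ∀ a b → addArc G v w a b ≡ true → (a ≡ v × b ≡ w) ⊎ G a b ≡ true
  addArc⁻ a b ab with a Fin.≟ v | b Fin.≟ w
  ... | yes a≡v | yes b≡w = inj₁ (a≡v , b≡w)
  ... | yes _   | no  _   = inj₂ ab
  ... | no  _   | _       = inj₂ ab

-- Serves the addition of a loop, where i starts one beyond j and the general analysis, which
-- assumes `pos w < pos v`, does not apply.
fwdScan-meet : ∀ {n} k (G : Graph n) {F B i j vtx c} → 1 ≤ k → (i <ᵇ j) ≡ false →
               fwdScan k G (sst F B i j vtx c) ≡ sst F B i j vtx (suc c)
fwdScan-meet (suc k) G _ eq rewrite eq = refl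

1+n≮ᵇn : ∀ k → (suc k <ᵇ k) ≡ false
1+n≮ᵇn zero    = refl
1+n≮ᵇn (suc k) = 1+n≮ᵇn k

vertex≥1 : ∀ {n} → Fin n → 1 ≤ n
vertex≥1 {suc n} _ = s≤s z≤n

cycleTest-false : ∀ {n} (G : Graph n) {F B} → cycleTest G F B ≡ false → ∀ {u z} → u ∈ F → z ∈ B → G u z ≡ false
cycleTest-false G {F} {B} eq {u} u∈ z∈ =
  All.lookup (any-false (G u) B (All.lookup (any-false (λ u → any (G u) B) F eq) u∈)) z∈

module _ {n} (G : Graph n) (pos : PArr n) (vtx : VArr n) (v w : Fin n) where

  Moved : PArr n → Set
  Moved pos₂ = (∀ x → pos x < pos₂ x → ∀ f → Topological (addArc G v w) f → f w ≤ f x)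
             × (∀ x → pos₂ x < pos x → ∀ f → Topological (addArc G v w) f → f x ≤ f v)

  data Added : Outcome n → Set where
    continued : ∀ {pos₂ vtx₂ c} → Valid (ast (addArc G v w) pos₂ vtx₂) → Moved pos₂ →
                c ≤ 24 * suc (sum (λ x → pos₂ x ∸ pos x)) → Added (continue (ast (addArc G v w) pos₂ vtx₂) c)
    cyclic    : ∀ {c} → c ≤ 13 * (n * n) → Added (cycle c)

  addition-added : Valid (ast G pos vtx) → Added (addition (ast G pos vtx) v w)
  addition-added (valid inv topo) with pos v <ᵇ pos w in lt
  ... | true = continued (valid inv topo′) ((λ x x<x → contradiction x<x (<-irrefl refl)) , (λ x x<x → contradiction x<x (<-irrefl refl)))
                 (s≤s z≤n)
    where
    topo′ : Topological (addArc G v w) pos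
    topo′ a b ab with addArc⁻ G v w a b ab
    ... | inj₁ (refl , refl) = <ᵇ⇒< (pos v) (pos w) (subst T (sym lt) _)
    ... | inj₂ ab′ = topo a b ab′
  ... | false with pos w <? pos v
  -- Equal positions mean that the arc is a loop. Both queues are then the single vertex v, the
  -- cycle test succeeds, and the total cost is 5.
  ...   | no w≮v with pos-injective inv v w (≤-antisym (≮⇒≥ w≮v) (≮⇒≥ λ v<w → subst T lt (<⇒<ᵇ v<w)))
  ...     | refl rewrite fwdScan-meet (2 * n + 5) (addArc G v v)
                           {[ v ]} {[ v ]} {suc (pos v)} {pos v} {setV (setV vtx (pos v) nothing) (pos v) nothing} {1}
                           (≤-trans (s≤s z≤n) (m≤n+m 5 (2 * n))) (1+n≮ᵇn (pos v))
                       | addArc-new G v v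
                  = cyclic (*-mono-≤ {5} {13} (s≤s (s≤s (s≤s (s≤s (s≤s z≤n))))) (*-mono-≤ (vertex≥1 v) (vertex≥1 v)))
  addition-added (valid inv topo) | false | yes w<v = goal
    where
    G′ : Graph n
    G′ = addArc G v w
    arcs : ∀ a b → G′ a b ≡ true → (a ≡ v × b ≡ w) ⊎ pos a < pos b
    arcs a b ab = Sum.map₂ (topo a b) (addArc⁻ G v w a b ab)
    open ReorderingCost G′ pos vtx inv v w arcs

    -- The part of `addition` that follows the search, as a function of the search state, so that
    -- `finish` can analyse an arbitrary state that satisfies `Finished`.
    outcome : SearchState n → Outcome n
    outcome s = if cycleTest G′ (SearchState.F s) (SearchState.B s)
        then cycle (1 + SearchState.cost s + suc (length (SearchState.F s) * length (SearchState.B s)))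
        else continue (ast G′ (ReState.rpos rB) (ReState.rvtx rB))
               (1 + SearchState.cost s + suc (length (SearchState.F s) * length (SearchState.B s)) + ReState.rcost rF + ReState.rcost rB)
      where
      rF = reorderF (2 * n + 5) G′ (rst (SearchState.F s) (SearchState.i s) (SearchState.vtx s) pos 0)
      rB = reorderB (2 * n + 5) G′ (rst (SearchState.B s) (SearchState.j s) (ReState.rvtx rF) (ReState.rpos rF) 0)

    fuel : ∀ {m} → m ≤ suc n → m < 2 * n + 5
    fuel m≤ = ≤-trans (s≤s m≤) (≤-trans (m≤m+n (2 + n) (n + 3)) (≤-reflexive (arith n)))
      where
      arith : ∀ a → 2 + a + (a + 3) ≡ 2 * a + 5
      arith = solve-∀

    finish : ∀ s → Finished s → Added (outcome s)
    finish (sst F B i j vtx′ c) (c′ , refl , refl , stopped) with stopped-split stopped | cycleTest G′ F B in test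
    ... | split | true  = cyclic (cycle-cost split)
    ... | split | false
      with reorderF-pass G′ (2 * n + 5) (suc n ∸ j) F j vtx′ pos 0 (fuel (m∸n≤m (suc n) j)) (Split.nulls-high split)
    ...   | costF , passF , refl
      with reorderB-pass G′ (2 * n + 5) (pred j) B j (ReState.rvtx (reorderF (2 * n + 5) G′ (rst F j vtx′ pos 0)))
             (ReState.rpos (reorderF (2 * n + 5) G′ (rst F j vtx′ pos 0))) 0
             (fuel (≤-trans pred[n]≤n (m≤n⇒m≤1+n (Split.t≤n split)))) ≤-refl
             (trans (nulls-cong (All.map (pass-outside G′ passF) (below-∉-from split))) (Split.nulls-low split))
    ...   | costB , passB , refl =
      continued (valid (numbering₂ split acyclic passF passB) (topological₂ split acyclic passF passB))
                (rises split acyclic passF passB , falls split acyclic passF passB) (total-cost split acyclic passF passB)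
      where
      acyclic : ∀ {u z} → u ∈ F → z ∈ B → G′ u z ≡ false
      acyclic = cycleTest-false G′ test

    goal : Added (outcome (search G′ pos vtx v w))
    goal = finish _ (search-stops w<v)

-- Sequences of arc additions

initState-valid : ∀ {n} (σ : Fin n ↔ Fin n) → Valid (initState σ)
initState-valid {n} σ = valid
  (record
    { unique = []
    ; pos≥1  = λ _ → s≤s z≤n
    ; pos≤n  = λ x → Fin.toℕ<n (Inverse.to σ x)
    ; held   = λ eq → held′ _ eq , λ ()
    ; placed = λ x → inj₂ (placed′ x)
    })
  (λ _ _ ())
  where
  held′ : ∀ p {x} → initVtx σ p ≡ just x → suc (toℕ (Inverse.to σ x)) ≡ p
  held′ (suc k) eq with k <? n
  held′ (suc k) refl | yes k<n = cong suc (trans (cong toℕ (Inverse.strictlyInverseˡ σ (fromℕ< k<n))) (Fin.toℕ-fromℕ< k<n))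
  placed′ : ∀ x → initVtx σ (suc (toℕ (Inverse.to σ x))) ≡ just x
  placed′ x with toℕ (Inverse.to σ x) <? n
  ... | yes p = cong just (trans (cong (Inverse.from σ) (Fin.fromℕ<-toℕ (Inverse.to σ x) p)) (Inverse.strictlyInverseʳ σ x))
  ... | no  ¬p = contradiction (Fin.toℕ<n (Inverse.to σ x)) ¬p

open Near using (potential; openPairs)

-- lam is the final numbering.  S marks pairs that are known to be ordered in every
-- topological numbering; the weight that it leaves open pays for future movement.
record RunBound {n} (s : AlgState n) (cost m : ℕ) : Set where
  open AlgState s
  field
    lam             : PArr n
    movement        : ℕ
    lam-topological : Topological graph lam
    lam-injective   : ∀ x y → lam x ≡ lam y → x ≡ y
    lam≤n           : ∀ x → lam x ≤ n
    cost≤           : cost ≤ 24 * (movement + m) + 13 * (n * n)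
    movement≤       : ∀ L S → (∀ x y → S x y ≡ true → ∀ f → Topological graph f → f y < f x) →
                      L * movement + potential L lam pos ≤ n * (n * n) + L * (n * openPairs L lam S)

open RunBound

module _ {n : ℕ} where

  -- Covers both ends of a run: no arcs left, or an addition that closes a cycle. The current
  -- numbering becomes `lam`, and its potential is at most n³.
  no-movement : ∀ {s : AlgState n} {cost m} → Valid s → cost ≤ 13 * (n * n) → RunBound s cost m
  no-movement {ast G pos vtx} {m = m} (valid inv topo) c≤ = record
    { lam             = pos
    ; movement        = 0
    ; lam-topological = topo
    ; lam-injective   = pos-injective inv
    ; lam≤n           = pos≤n inv
    ; cost≤           = ≤-trans c≤ (m≤n+m _ (24 * m))
    ; movement≤       = λ L S _ → ≤-trans (≤-reflexive (cong (_+ potential L pos pos) (*-zeroʳ L)))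
        (≤-trans (sum-≤-const (n * n) (λ x → *-mono-≤ (pos≤n inv x) (pos≤n inv x))) (m≤m+n _ _))
    }

  -- A numbering that is topological for the larger graph is so for the smaller one, so the `lam` of
  -- the later run also serves this addition. There it satisfies lam y ≤ lam v < lam w ≤ lam x
  -- whenever x rises and y falls, as the slice argument requires.
  extend : ∀ {G : Graph n} {pos vtx v w pos₂ vtx₂ c rest m} → Valid (ast G pos vtx) →
           Valid (ast (addArc G v w) pos₂ vtx₂) → Moved G pos vtx v w pos₂ →
           c ≤ 24 * suc (sum (λ x → pos₂ x ∸ pos x)) →
           RunBound (ast (addArc G v w) pos₂ vtx₂) rest m → RunBound (ast G pos vtx) (c + rest) (suc m)
  extend {G} {pos} {vtx} {v} {w} {pos₂} {vtx₂} {c} {rest} {m} (valid inv topo) (valid inv₂ topo₂) (rise , fall) c≤ later = record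
    { lam             = lam later
    ; movement        = moved + movement later
    ; lam-topological = restrict (lam-topological later)
    ; lam-injective   = lam-injective later
    ; lam≤n           = lam≤n later
    ; cost≤           = ≤-trans (+-mono-≤ c≤ (cost≤ later)) (≤-reflexive (arith moved (movement later) m (13 * (n * n))))
    ; movement≤       = bound
    }
    where
    moved = sum (λ x → pos₂ x ∸ pos x)
    G′ = addArc G v w
    arith : ∀ a b m k → 24 * suc a + (24 * (b + m) + k) ≡ 24 * (a + b + suc m) + k
    arith = solve-∀
    restrict : ∀ {f} → Topological G′ f → Topological G f
    restrict topo-f a b ab = topo-f a b (addArc-old G v w ab)
    crosses : ∀ f → Topological G′ f → ∀ x y → pos x < pos₂ x → pos₂ y < pos y → f y < f x
    crosses f topo-f x y up down = ≤-<-trans (fall y down f topo-f) (<-≤-trans (topo-f v w (addArc-new G v w)) (rise x up f topo-f))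
    module Sl L = Slices pos pos₂
      (λ p → trans (sum-positions inv (λ q → ind (q ≤? p))) (sym (sum-positions inv₂ (λ q → ind (q ≤? p)))))
      (pos≤n inv) (pos≤n inv₂) L (lam later)
      (λ x y up down → <⇒≤ (crosses (lam later) (lam-topological later) x y up down))
    bound : ∀ L S → (∀ x y → S x y ≡ true → ∀ f → Topological G f → f y < f x) →
            L * (moved + movement later) + potential L (lam later) pos ≤ n * (n * n) + L * (n * openPairs L (lam later) S)
    -- The potential and the open weight after this addition occur on both sides and cancel, so the
    -- bounds for single additions telescope.
    bound L S sound = +-cancelʳ-≤ (Φ₂ + O₂) _ _ (begin
      L * (moved + movement later) + Φ + (Φ₂ + O₂)        ≡⟨ rearrange L moved (movement later) Φ Φ₂ O₂ ⟩
      (L * moved + Φ + O₂) + (L * movement later + Φ₂)    ≤⟨ +-mono-≤ (Sl.step L S ordered) (movement≤ later L S₂ sound₂) ⟩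
      (Φ₂ + L * (n * openPairs L (lam later) S)) + (n * (n * n) + O₂) ≡⟨ rearrange₂ Φ₂ _ (n * (n * n)) O₂ ⟩
      n * (n * n) + L * (n * openPairs L (lam later) S) + (Φ₂ + O₂) ∎)
      where
      open ≤-Reasoning
      ordered : ∀ x y → S x y ≡ true → pos y < pos x
      ordered x y Sxy = sound x y Sxy pos topo
      S₂ = Sl.S′ L S ordered
      Φ = potential L (lam later) pos
      Φ₂ = potential L (lam later) pos₂
      O₂ = L * (n * openPairs L (lam later) S₂)
      sound₂ : ∀ x y → S₂ x y ≡ true → ∀ f → Topological G′ f → f y < f x
      sound₂ x y S₂xy f topo-f with S x y in Sxy
      ... | true = sound x y Sxy f (restrict topo-f)
      ... | false with Sl.crossed? L S ordered x y
      ...   | yes ((up , down) , _) = crosses f topo-f x y up down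
      ...   | no  ¬crossed = contradiction (trans (sym S₂xy) (dec-false (Sl.crossed? L S ordered x y) ¬crossed)) λ ()
      rearrange : ∀ l a b p q r → l * (a + b) + p + (q + r) ≡ (l * a + p + r) + (l * b + q)
      rearrange = solve-∀
      rearrange₂ : ∀ a b c d → (a + b) + (c + d) ≡ c + b + (a + d)
      rearrange₂ = solve-∀

  run-bound : ∀ {s : AlgState n} → Valid s → ∀ arcs → RunBound s (runCost s arcs) (length arcs)
  run-bound ok [] = no-movement ok z≤n
  run-bound {ast G pos vtx} ok ((v , w) ∷ arcs) with addition (ast G pos vtx) v w | addition-added G pos vtx v w ok
  ... | _ | cyclic c≤            = no-movement ok c≤
  ... | _ | continued ok₂ mv c≤ = extend ok ok₂ mv c≤ (run-bound ok₂ arcs)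

-- Choice of L and the final estimate

isqrt : ∀ n → ∃ λ L → L * L ≤ n × n < suc L * suc L
isqrt zero = 0 , z≤n , s≤s z≤n
isqrt (suc n) with isqrt n
... | L , L²≤n , n<L₁² with suc n <? suc L * suc L
...   | yes below = L , ≤-trans L²≤n (n≤1+n n) , below
...   | no  above = suc L , ≮⇒≥ above , ≤-<-trans n<L₁² (*-mono-< (n<1+n (suc L)) (n<1+n (suc L)))

-- The sum is at most twice the larger term, whose square is at most the sum of the squares.
square-+≤ : ∀ a b → (a + b) * (a + b) ≤ 4 * (a * a + b * b)
square-+≤ a b with ≤-total a b
... | inj₁ a≤b = ≤-trans (*-mono-≤ (+-monoˡ-≤ b a≤b) (+-monoˡ-≤ b a≤b))
                   (≤-trans (≤-reflexive (arith b)) (*-monoʳ-≤ 4 (m≤n+m (b * b) (a * a))))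
  where
  arith : ∀ b → (b + b) * (b + b) ≡ 4 * (b * b)
  arith = solve-∀
... | inj₂ b≤a = ≤-trans (*-mono-≤ (+-monoʳ-≤ a b≤a) (+-monoʳ-≤ a b≤a))
                   (≤-trans (≤-reflexive (arith a)) (*-monoʳ-≤ 4 (m≤m+n (a * a) (b * b))))
  where
  arith : ∀ b → (b + b) * (b + b) ≡ 4 * (b * b)
  arith = solve-∀

unique-arcs≤ : ∀ {n} {arcs : List (Fin n × Fin n)} → Unique arcs → length arcs ≤ n * n
unique-arcs≤ {n} {arcs} uniq = subst (_≤ n * n) (List.length-map code arcs)
  (unique-length≤ (Unique.map⁺ (λ {x} {y} → code-injective x y) uniq))
  where
  code : Fin n × Fin n → Fin (n * n)
  code (a , b) = Fin.combine a b
  code-injective : ∀ x y → code x ≡ code y → x ≡ y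
  code-injective (a , b) (c , d) eq with Fin.combine-injective a b c d eq
  ... | refl , refl = refl

-- The two terms of the bound on the movement, n³ / L and L n², balance for L = √n.
movement²≤ : ∀ {n T} → 1 ≤ n → (∀ L → L * T ≤ n * (n * n) + L * (n * (n * L))) → T * T ≤ 16 * (n * n * n * n * n)
movement²≤ {n@(suc _)} {T} n≥1 hyp with isqrt n
... | zero , _ , n<1 = contradiction n<1 (≤⇒≯ n≥1)
... | L@(suc _) , L²≤n , n<L₁² = *-cancelˡ-≤ n (begin
  -- The factor n is traded for 4 L², which turns T² into (L T)², the quantity that the hypothesis
  -- bounds by 4 n⁶.
  n * (T * T)                                     ≤⟨ *-monoˡ-≤ (T * T) n≤4L² ⟩
  4 * (L * L) * (T * T)                           ≡⟨ arith₁ L T ⟩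
  4 * ((L * T) * (L * T))                         ≤⟨ *-monoʳ-≤ 4 (*-mono-≤ LT≤ LT≤) ⟩
  4 * ((2 * (n * n * n)) * (2 * (n * n * n)))     ≡⟨ arith₂ n ⟩
  n * (16 * (n * n * n * n * n))                  ∎)
  where
  open ≤-Reasoning
  arith₁ : ∀ l t → 4 * (l * l) * (t * t) ≡ 4 * ((l * t) * (l * t))
  arith₁ = solve-∀
  arith₂ : ∀ n → 4 * ((2 * (n * n * n)) * (2 * (n * n * n))) ≡ n * (16 * (n * n * n * n * n))
  arith₂ = solve-∀
  arith₃ : ∀ l → (l + l) * (l + l) ≡ 4 * (l * l)
  arith₃ = solve-∀
  arith₄ : ∀ l n → n * (n * n) + l * (n * (n * l)) ≡ n * n * n + l * l * (n * n)
  arith₄ = solve-∀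
  arith₅ : ∀ n → n * n * n + n * (n * n) ≡ 2 * (n * n * n)
  arith₅ = solve-∀
  n≤4L² : n ≤ 4 * (L * L)
  n≤4L² = ≤-trans (<⇒≤ n<L₁²) (≤-trans (*-mono-≤ 1+L≤2L 1+L≤2L) (≤-reflexive (arith₃ L)))
    where
    1+L≤2L : suc L ≤ L + L
    1+L≤2L = +-monoˡ-≤ L (s≤s z≤n)
  LT≤ : L * T ≤ 2 * (n * n * n)
  LT≤ = begin
    L * T                              ≤⟨ hyp L ⟩
    n * (n * n) + L * (n * (n * L))    ≡⟨ arith₄ L n ⟩
    n * n * n + L * L * (n * n)        ≤⟨ +-monoʳ-≤ (n * n * n) (*-monoˡ-≤ (n * n) L²≤n) ⟩
    n * n * n + n * (n * n)            ≡⟨ arith₅ n ⟩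
    2 * (n * n * n)                    ∎

-- The total is at most 37 (M + n²), where 37 = 24 + 13. Squaring gives 37² · 4 · (16 + 1) = 93092,
-- the 16 coming from M² and the 1 from n⁴ ≤ n⁵.
totalCost²≤ : ∀ n (σ : Fin n ↔ Fin n) arcs → Unique arcs → totalCost σ arcs ^ 2 ≤ 93092 * n ^ 5
totalCost²≤ zero σ [] uniq = z≤n
totalCost²≤ n@(suc _) σ arcs uniq = begin
  totalCost σ arcs ^ 2                  ≡⟨ cong (totalCost σ arcs *_) (*-identityʳ _) ⟩
  totalCost σ arcs * totalCost σ arcs   ≤⟨ *-mono-≤ total≤ total≤ ⟩
  (37 * (M + N)) * (37 * (M + N))       ≡⟨ arith₁ (M + N) ⟩
  1369 * ((M + N) * (M + N))            ≤⟨ *-monoʳ-≤ 1369 (square-+≤ M N) ⟩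
  1369 * (4 * (M * M + N * N))          ≤⟨ *-monoʳ-≤ 1369 (*-monoʳ-≤ 4 (+-mono-≤ M²≤ N²≤)) ⟩
  1369 * (4 * (16 * n⁵ + n⁵))           ≡⟨ arith₂ n⁵ ⟩
  93092 * n⁵                            ≡⟨ cong (93092 *_) (arith₃ n) ⟩
  93092 * n ^ 5                         ∎
  where
  open ≤-Reasoning
  bound = run-bound (initState-valid σ) arcs
  M = movement bound
  N = n * n
  n⁵ = n * n * n * n * n
  arith₁ : ∀ a → (37 * a) * (37 * a) ≡ 1369 * (a * a)
  arith₁ = solve-∀
  arith₂ : ∀ a → 1369 * (4 * (16 * a + a)) ≡ 93092 * a
  arith₂ = solve-∀
  arith₃ : ∀ a → a * a * a * a * a ≡ a * (a * (a * (a * (a * 1))))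
  arith₃ = solve-∀
  arith₄ : ∀ a b → 24 * (a + b) + 13 * b + 13 * a ≡ 37 * (a + b)
  arith₄ = solve-∀
  arith₅ : ∀ a → a * a * (a * a) * a ≡ a * a * a * a * a
  arith₅ = solve-∀
  total≤ : totalCost σ arcs ≤ 37 * (M + N)
  total≤ = begin
    totalCost σ arcs                     ≤⟨ cost≤ bound ⟩
    24 * (M + length arcs) + 13 * N      ≤⟨ +-monoˡ-≤ (13 * N) (*-monoʳ-≤ 24 (+-monoʳ-≤ M (unique-arcs≤ uniq))) ⟩
    -- Padding by 13 M makes the bound a multiple of M + N.
    24 * (M + N) + 13 * N                ≤⟨ m≤m+n _ (13 * M) ⟩
    24 * (M + N) + 13 * N + 13 * M       ≡⟨ arith₄ M N ⟩
    37 * (M + N)                         ∎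
  M²≤ : M * M ≤ 16 * n⁵
  M²≤ = movement²≤ {n} {M} (s≤s z≤n) λ L → begin
    L * M                                                       ≤⟨ m≤m+n _ _ ⟩
    -- At the start no pair is known to be ordered, so S is empty.
    L * M + potential L (lam bound) _                           ≤⟨ movement≤ bound L (λ _ _ → false) (λ _ _ ()) ⟩
    n * (n * n) + L * (n * openPairs L (lam bound) (λ _ _ → false))
      ≤⟨ +-monoʳ-≤ (n * (n * n)) (*-monoʳ-≤ L (*-monoʳ-≤ n (Near.openPairs≤ L (lam bound) (lam-injective bound) _))) ⟩
    n * (n * n) + L * (n * (n * L))                             ∎
  N²≤ : N * N ≤ n⁵
  N²≤ = ≤-trans (m≤m*n (N * N) n) (≤-reflexive (arith₅ n))

theorem5p6 : ∃ λ (c : ℕ) → ∀ (n : ℕ) (σ : Fin n ↔ Fin n) (arcs : List (Fin n × Fin n)) → Unique arcs → totalCost σ arcs ^ 2 ≤ c * n ^ 5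
theorem5p6 = 93092 , totalCost²≤
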